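{- Let $H$ be a finite abelian group. Then there exists a natural number $k_H$ depending on $H$ such that for all integers $k>k_H$ there does not exist a simple graph $G$ with $\mathrm{Jac}(G)\cong (\mathbb{Z}/2\mathbb{Z})^k\times H$ as groups.
   Context: A graph is a finite connected graph, possibly with multiple edges, but without loops; a simple graph is a graph without multiple edges. A divisor on $G$ is a formal integral combination $D=\sum_{v\in V(G)} D(v)v$, of degree $\sum_v D(v)$. For $f: V(G)\to\mathbb{Z}$ put $\mathrm{div}(f)=\sum_{v}\big(\sum_{e=vw}(f(v)-f(w))\big)v$, the inner sum being over edges $e$ containing $v$ (counted with multiplicity). The Jacobian $\mathrm{Jac}(G)$ is the (finite) group of degree-zero divisors modulo the subgroup of divisors of the form $\mathrm{div}(f)$. -}

module Defs where

open import Level using (Level; 0ℓ; _⊔_)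
open import Algebra.Bundles using (AbelianGroup)
import Algebra.Construct.DirectProduct as DirectProduct
import Algebra.Construct.Pointwise as Pointwise
open import Algebra.Morphism.Structures using (module GroupMorphisms)
open import Data.Fin.Base using (Fin)
open import Data.Integer.Base using (ℤ; +_; 0ℤ; _+_; _-_; _*_; -_)
import Data.Integer.Properties as ℤ
open import Data.Integer.Tactic.RingSolver using (solve-∀)
open import Data.Nat.Base as ℕ using (ℕ; zero; suc; NonZero)
import Data.Parity.Properties as ℙ
open import Data.Product.Base using (Σ-syntax; ∃-syntax; _,_)
open import Function.Bundles using (Inverse)
open import Relation.Binary.Construct.Closure.ReflexiveTransitive using (Star)
open import Relation.Binary.PropositionalEquality

open import Algebra.Properties.CommutativeMonoid.Sum ℤ.+-0-commutativeMonoid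
  using (sum; sum-syntax; sum-cong-≗; sum-replicate-zero; ∑-distrib-+)

-- Vertices are Fin order, and mult v w is the number of edges joining v
-- and w.  The empty graph is not connected.
record Graph : Set where
  field
    order     : ℕ
    nonEmpty  : NonZero order

  Vertex : Set
  Vertex = Fin order

  field
    mult      : Vertex → Vertex → ℕ
    symmetric : ∀ v w → mult v w ≡ mult w v
    loopless  : ∀ v → mult v v ≡ 0

  Adjacent : Vertex → Vertex → Set
  Adjacent v w = 0 ℕ.< mult v w

  field
    connected : ∀ v w → Star Adjacent v w

IsSimple : Graph → Set
IsSimple G = ∀ v w → mult v w ℕ.≤ 1
  where open Graph G

module _ (G : Graph) where
  open Graph G

  Divisor : Set
  Divisor = Vertex → ℤ

  degree : Divisor → ℤ
  degree D = ∑[ v < order ] D v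

  div : (Vertex → ℤ) → Divisor
  div f v = ∑[ w < order ] (+ mult v w * (f v - f w))

  Divisor⁰ : Set
  Divisor⁰ = Σ[ D ∈ Divisor ] degree D ≡ 0ℤ

  infix 4 _∼_

  _∼_ : Divisor → Divisor → Set
  D ∼ E = ∃[ f ] (∀ v → D v - E v ≡ div f v)

sum-neg : ∀ {n} (f : Fin n → ℤ) → sum (λ i → - f i) ≡ - sum f
sum-neg {zero}  f = refl
sum-neg {suc n} f =
  trans (cong (_+_ (- f Fin.zero)) (sum-neg (λ i → f (Fin.suc i))))
        (sym (ℤ.neg-distrib-+ (f Fin.zero) (sum (λ i → f (Fin.suc i)))))

module _ (G : Graph) where
  open Graph G

  div-0 : ∀ v → div G (λ _ → 0ℤ) v ≡ 0ℤ
  div-0 v = trans (sum-cong-≗ (λ w → ℤ.*-zeroʳ (+ mult v w)))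
                  (sum-replicate-zero order)

  div-+ : ∀ f g v → div G (λ w → f w + g w) v ≡ div G f v + div G g v
  div-+ f g v =
    trans (sum-cong-≗ (λ w → lemma (+ mult v w) (f v) (f w) (g v) (g w)))
          (∑-distrib-+ (λ w → + mult v w * (f v - f w))
                       (λ w → + mult v w * (g v - g w)))
    where
    lemma : ∀ m a b c d →
            m * ((a + c) - (b + d)) ≡ m * (a - b) + m * (c - d)
    lemma = solve-∀

  div-neg : ∀ f v → div G (λ w → - f w) v ≡ - div G f v
  div-neg f v =
    trans (sum-cong-≗ (λ w → lemma (+ mult v w) (f v) (f w)))
          (sum-neg (λ w → + mult v w * (f v - f w)))
    where
    lemma : ∀ m a b → m * (- a - - b) ≡ - (m * (a - b))
    lemma = solve-∀

  ≗⇒∼ : ∀ {D E : Divisor G} → D ≗ E → _∼_ G D E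
  ≗⇒∼ D≗E = (λ _ → 0ℤ) , λ v →
    trans (ℤ.i≡j⇒i-j≡0 (D≗E v)) (sym (div-0 v))

  Jac : AbelianGroup 0ℓ 0ℓ
  Jac = record
    { Carrier = Divisor⁰ G
    ; _≈_     = λ (D , _) (E , _) → _∼_ G D E
    ; _∙_     = λ (D , p) (E , q) →
        (λ v → D v + E v) , trans (∑-distrib-+ D E) (cong₂ _+_ p q)
    ; ε       = (λ _ → 0ℤ) , sum-replicate-zero order
    ; _⁻¹     = λ (D , p) → (λ v → - D v) , trans (sum-neg D) (cong -_ p)
    ; isAbelianGroup = record
      { isGroup = record
        { isMonoid = record
          { isSemigroup = record
            { isMagma = record
              { isEquivalence = record
                { refl  = λ {(D , _)} → ≗⇒∼ {D} (λ _ → refl)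
                ; sym   = λ {(D , _)} {(E , _)} (f , p) → (λ v → - f v) , λ v →
                    trans (sub-sym (D v) (E v))
                          (trans (cong -_ (p v)) (sym (div-neg f v)))
                ; trans = λ {(D , _)} {(E , _)} {(F , _)} (f , p) (g , q) →
                    (λ v → f v + g v) , λ v →
                    trans (sub-trans (D v) (E v) (F v))
                          (trans (cong₂ _+_ (p v) (q v)) (sym (div-+ f g v)))
                }
              ; ∙-cong = λ {(D , _)} {(D′ , _)} {(E , _)} {(E′ , _)} (f , p) (g , q) →
                  (λ v → f v + g v) , λ v →
                  trans (sub-+ (D v) (D′ v) (E v) (E′ v))
                        (trans (cong₂ _+_ (p v) (q v)) (sym (div-+ f g v)))
              }
            ; assoc = λ (D , _) (E , _) (F , _) →
                ≗⇒∼ (λ v → ℤ.+-assoc (D v) (E v) (F v))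
            }
          ; identity = (λ (D , _) → ≗⇒∼ (λ v → ℤ.+-identityˡ (D v)))
                     , (λ (D , _) → ≗⇒∼ (λ v → ℤ.+-identityʳ (D v)))
          }
        ; inverse = (λ (D , _) → ≗⇒∼ (λ v → ℤ.+-inverseˡ (D v)))
                  , (λ (D , _) → ≗⇒∼ (λ v → ℤ.+-inverseʳ (D v)))
        ; ⁻¹-cong = λ {(D , _)} {(E , _)} (f , p) → (λ v → - f v) , λ v →
            trans (sub-neg (D v) (E v))
                  (trans (cong -_ (p v)) (sym (div-neg f v)))
        }
      ; comm = λ (D , _) (E , _) → ≗⇒∼ (λ v → ℤ.+-comm (D v) (E v))
      }
    }
    where
    sub-sym : ∀ a b → b - a ≡ - (a - b)
    sub-sym = solve-∀

    sub-trans : ∀ a b c → a - c ≡ (a - b) + (b - c)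
    sub-trans = solve-∀

    sub-+ : ∀ a a′ b b′ → (a + b) - (a′ + b′) ≡ (a - a′) + (b - b′)
    sub-+ = solve-∀

    sub-neg : ∀ a b → - a - - b ≡ - (a - b)
    sub-neg = solve-∀

private
  variable
    a b ℓ₁ ℓ₂ : Level

infix  4 _≅_
infixr 6 _×ᴳ_

IsFinite : AbelianGroup a ℓ₁ → Set (a ⊔ ℓ₁)
IsFinite A = ∃[ n ] Inverse (AbelianGroup.setoid A) (setoid (Fin n))

_≅_ : AbelianGroup a ℓ₁ → AbelianGroup b ℓ₂ → Set (a ⊔ b ⊔ ℓ₁ ⊔ ℓ₂)
A ≅ B = Σ[ φ ∈ (A.Carrier → B.Carrier) ] IsGroupIsomorphism φ
  where
  module A = AbelianGroup A
  module B = AbelianGroup B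
  open GroupMorphisms A.rawGroup B.rawGroup

_×ᴳ_ : AbelianGroup a ℓ₁ → AbelianGroup b ℓ₂ → AbelianGroup (a ⊔ b) (ℓ₁ ⊔ ℓ₂)
_×ᴳ_ = DirectProduct.abelianGroup

-- The additive group of parities, 0ℙ and 1ℙ.
ℤ/2 : AbelianGroup 0ℓ 0ℓ
ℤ/2 = ℙ.+-0-abelianGroup

infixr 8 _^ᴳ_

_^ᴳ_ : AbelianGroup a ℓ₁ → ℕ → AbelianGroup a ℓ₁
A ^ᴳ k = Pointwise.abelianGroup (Fin k) A

{-# OPTIONS --safe #-}

-- Let M > 0 kill Jac(G), and for an edge e = vw choose f with div f = M(v − w).
-- Then r_e = 2 grad f − M e is M times the image of e under the reflection in
-- the cut space; it is an integral chain, and the r_e are pairwise orthogonal of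
-- equal norm.  If M divides r_e, the reflection sends e to an integral chain with
-- the norm and boundary of e; as G is simple this chain is e itself, so e is a
-- bridge and v ∼ w.  Modulo M, r_e depends only on 2(v − w), hence only on the
-- H-component of v − w.  So among the edges with a given H-component that are
-- nontrivial in Jac(G), all r_e are nonzero at one common coordinate, and
-- Bessel's inequality bounds their number in terms of M alone.  Since edges
-- generate Jac(G), a large k would yield too many edges with distinct nonzero
-- (ℤ/2)ᵏ-components.
module Submission where

open import Defs
open import Algebra.Bundles using (AbelianGroup)
open import Data.Nat.Base using (ℕ; _>_)
open import Data.Product.Base using (∃-syntax; _×_)
open import Level using (Level)
open import Relation.Nullary.Negation.Core using (¬_)

open import Algebra.Morphism.Structures using (module GroupMorphisms)
import Algebra.Properties.Group as GroupProperties
import Algebra.Properties.Monoid.Mult as Mult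
open import Data.Fin.Base using (Fin; zero; suc; toℕ; fromℕ<; funToFin; finToFun)
import Data.Fin.Properties as Fin
open import Data.Integer.Base hiding (suc; _>_)
open import Data.Integer.Divisibility.Signed using (_∣_; divides; _∣?_)
import Data.Integer.Properties as ℤ
open import Data.Integer.Tactic.RingSolver using (solve-∀)
open import Data.Nat.Base as ℕ using (zero; suc; z≤n; s≤s; _!)
import Data.Nat.Divisibility as ℕ
import Data.Nat.Properties as ℕ
open import Data.Parity.Base as ℙ using (Parity; 0ℙ; 1ℙ)
import Data.Parity.Properties as ℙ
open import Data.Product.Base using (Σ-syntax; ∃₂; _,_; proj₁; proj₂)
open import Data.Sum.Base using (_⊎_; inj₁; inj₂)
open import Function.Base using (_∘_)
open import Function.Bundles using (module Inverse)
open import Relation.Binary.Construct.Closure.ReflexiveTransitive using (Star; ε; _◅_)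
open import Relation.Binary.PropositionalEquality
open import Relation.Nullary.Decidable.Core using (yes; no; ¬?; _×-dec_; decidable-stable)
open import Relation.Nullary.Negation.Core using (contradiction)

open import Algebra.Properties.Semiring.Sum ℤ.+-*-semiring
  using (sum; sum-syntax; sum-cong-≗; sum-replicate-zero; ∑-distrib-+; ∑-comm;
         *-distribˡ-sum; *-distribʳ-sum)

-- Sums of integers

i*i≥0 : ∀ i → 0ℤ ≤ i * i
i*i≥0 (+ zero)  = +≤+ z≤n
i*i≥0 +[1+ n ]  = +≤+ z≤n
i*i≥0 (-[1+ n ]) = +≤+ z≤n

i≢0⇒1≤i*i : ∀ {i} → i ≢ 0ℤ → 1ℤ ≤ i * i
i≢0⇒1≤i*i {+ zero}     i≢0 = contradiction refl i≢0
i≢0⇒1≤i*i { +[1+ n ] } _   = +≤+ (s≤s z≤n)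
i≢0⇒1≤i*i { -[1+ n ] } _   = +≤+ (s≤s z≤n)

i*i≡0⇒i≡0 : ∀ {i} → i * i ≡ 0ℤ → i ≡ 0ℤ
i*i≡0⇒i≡0 {i} eq with ℤ.i*j≡0⇒i≡0∨j≡0 i eq
... | inj₁ p = p
... | inj₂ p = p

i≡-i⇒i≡0 : ∀ {i} → i ≡ - i → i ≡ 0ℤ
i≡-i⇒i≡0 {+ zero}     _  = refl
i≡-i⇒i≡0 { +[1+ n ] } ()
i≡-i⇒i≡0 { -[1+ n ] } ()

sum-lin : ∀ {n} a b (s t : Fin n → ℤ) →
          ∑[ i < n ] (a * s i + b * t i) ≡ a * sum s + b * sum t
sum-lin a b s t =
  trans (∑-distrib-+ (λ i → a * s i) (λ i → b * t i))
        (cong₂ _+_ (sym (*-distribˡ-sum a s)) (sym (*-distribˡ-sum b t)))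

sum-mono : ∀ {n} {s t : Fin n → ℤ} → (∀ i → s i ≤ t i) → sum s ≤ sum t
sum-mono {zero}  s≤t = ℤ.≤-refl
sum-mono {suc n} s≤t = ℤ.+-mono-≤ (s≤t zero) (sum-mono (s≤t ∘ suc))

sum-const : ∀ n c → ∑[ _ < n ] c ≡ + n * c
sum-const zero    c = sym (ℤ.*-zeroˡ c)
sum-const (suc n) c =
  trans (cong (_+_ c) (sum-const n c)) (sym (ℤ.suc-* (+ n) c))

sum-nonNeg : ∀ {n} {t : Fin n → ℤ} → (∀ i → 0ℤ ≤ t i) → 0ℤ ≤ sum t
sum-nonNeg {n} 0≤t = ℤ.≤-trans (ℤ.≤-reflexive (sym (sum-replicate-zero n))) (sum-mono 0≤t)

term≤sum : ∀ {n} {t : Fin n → ℤ} → (∀ i → 0ℤ ≤ t i) → ∀ i → t i ≤ sum t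
term≤sum {t = t} 0≤t zero    =
  ℤ.≤-trans (ℤ.≤-reflexive (sym (ℤ.+-identityʳ _))) (ℤ.+-monoʳ-≤ (t zero) (sum-nonNeg (0≤t ∘ suc)))
term≤sum 0≤t (suc i) =
  ℤ.≤-trans (ℤ.≤-reflexive (sym (ℤ.+-identityˡ _))) (ℤ.+-mono-≤ (0≤t zero) (term≤sum (0≤t ∘ suc) i))

-- The Kronecker delta

δ : ∀ {n} → Fin n → Fin n → ℤ
δ zero    zero    = 1ℤ
δ zero    (suc _) = 0ℤ
δ (suc _) zero    = 0ℤ
δ (suc i) (suc j) = δ i j

δ-diag : ∀ {n} (i : Fin n) → δ i i ≡ 1ℤ
δ-diag zero    = refl
δ-diag (suc i) = δ-diag i

δ-off : ∀ {n} {i j : Fin n} → i ≢ j → δ i j ≡ 0ℤ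
δ-off {i = zero}  {zero}  i≢j = contradiction refl i≢j
δ-off {i = zero}  {suc j} _   = refl
δ-off {i = suc i} {zero}  _   = refl
δ-off {i = suc i} {suc j} i≢j = δ-off (i≢j ∘ cong suc)

δ-subst : ∀ {n} (i j : Fin n) (t : Fin n → ℤ) → δ i j * t j ≡ δ i j * t i
δ-subst i j t with i Fin.≟ j
... | yes refl = refl
... | no i≢j   = trans (cong (_* t j) (δ-off i≢j)) (sym (cong (_* t i) (δ-off i≢j)))

sum-δ : ∀ {n} i (t : Fin n → ℤ) → ∑[ j < n ] (δ i j * t j) ≡ t i
sum-δ {suc n} zero    t =
  trans (cong₂ _+_ (ℤ.*-identityˡ (t zero)) (sum-replicate-zero n)) (ℤ.+-identityʳ _)
sum-δ {suc n} (suc i) t = trans (ℤ.+-identityˡ _) (sum-δ i (t ∘ suc))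

sum-δ-1 : ∀ {n} (i : Fin n) → ∑[ j < n ] δ i j ≡ 1ℤ
sum-δ-1 i = trans (sum-cong-≗ (λ j → sym (ℤ.*-identityʳ (δ i j)))) (sum-δ i (λ _ → 1ℤ))

-- Matrices with the entrywise inner product

Matrix : ℕ → Set
Matrix n = Fin n → Fin n → ℤ

sum₂ : ∀ {n} → Matrix n → ℤ
sum₂ {n} a = ∑[ v < n ] ∑[ w < n ] a v w

sum₂-cong : ∀ {n} {a b : Matrix n} → (∀ v w → a v w ≡ b v w) → sum₂ a ≡ sum₂ b
sum₂-cong a≡b = sum-cong-≗ (λ v → sum-cong-≗ (a≡b v))

sum₂-lin : ∀ {n} x y (a b : Matrix n) →
           sum₂ (λ v w → x * a v w + y * b v w) ≡ x * sum₂ a + y * sum₂ b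
sum₂-lin x y a b =
  trans (sum-cong-≗ (λ v → sum-lin x y (a v) (b v))) (sum-lin x y (sum ∘ a) (sum ∘ b))

sum₂-scale : ∀ {n} x (a : Matrix n) → sum₂ (λ v w → x * a v w) ≡ x * sum₂ a
sum₂-scale x a =
  trans (sum-cong-≗ (λ v → sym (*-distribˡ-sum x (a v)))) (sym (*-distribˡ-sum x (sum ∘ a)))

term≤sum₂ : ∀ {n} {a : Matrix n} → (∀ v w → 0ℤ ≤ a v w) → ∀ v w → a v w ≤ sum₂ a
term≤sum₂ 0≤a v w =
  ℤ.≤-trans (term≤sum (0≤a v) w) (term≤sum (λ v′ → sum-nonNeg (0≤a v′)) v)

sum₂≡0⇒≡0 : ∀ {n} {a : Matrix n} → (∀ v w → 0ℤ ≤ a v w) → sum₂ a ≡ 0ℤ →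
            ∀ v w → a v w ≡ 0ℤ
sum₂≡0⇒≡0 0≤a eq v w =
  ℤ.≤-antisym (ℤ.≤-trans (term≤sum₂ 0≤a v w) (ℤ.≤-reflexive eq)) (0≤a v w)

-- Divisibility is decidable and there are finitely many entries, so a failing one is found by
-- search, constructively.
nonmultiple-entry : ∀ {n} m (a : Matrix n) → ¬ (∀ p q → m ∣ a p q) → ∃₂ λ p q → ¬ m ∣ a p q
nonmultiple-entry {n} m a ¬all
  with p , ¬row ← Fin.¬∀⟶∃¬ n _ (λ p → Fin.all? (λ q → m ∣? a p q)) ¬all
  with q , ¬m∣ ← Fin.¬∀⟶∃¬ n _ (λ q → m ∣? a p q) ¬row
  = p , q , ¬m∣

-- An edge of a graph contributes twice, once for each orientation.
⟪_,_⟫ : ∀ {n} → Matrix n → Matrix n → ℤ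
⟪ a , b ⟫ = sum₂ (λ v w → a v w * b v w)

⟪⟫-comm : ∀ {n} (a b : Matrix n) → ⟪ a , b ⟫ ≡ ⟪ b , a ⟫
⟪⟫-comm a b = sum₂-cong (λ v w → ℤ.*-comm (a v w) (b v w))

⟪a,a⟫≡0⇒a≡0 : ∀ {n} (a : Matrix n) → ⟪ a , a ⟫ ≡ 0ℤ → ∀ v w → a v w ≡ 0ℤ
⟪a,a⟫≡0⇒a≡0 a eq v w =
  i*i≡0⇒i≡0 (sum₂≡0⇒≡0 (λ v w → i*i≥0 (a v w)) eq v w)

⟪⟫-lin : ∀ {n} x y z t (a b c d : Matrix n) →
         ⟪ (λ v w → x * a v w + y * b v w) , (λ v w → z * c v w + t * d v w) ⟫
         ≡ x * z * ⟪ a , c ⟫ + x * t * ⟪ a , d ⟫ + (y * z * ⟪ b , c ⟫ + y * t * ⟪ b , d ⟫)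
⟪⟫-lin x y z t a b c d = begin
  ⟪ (λ v w → x * a v w + y * b v w) , (λ v w → z * c v w + t * d v w) ⟫
    ≡⟨ sum₂-cong (λ v w → expand x y z t (a v w) (b v w) (c v w) (d v w)) ⟩
  sum₂ (λ v w → 1ℤ * (x * z * (a v w * c v w) + x * t * (a v w * d v w))
              + 1ℤ * (y * z * (b v w * c v w) + y * t * (b v w * d v w)))
    ≡⟨ sum₂-lin 1ℤ 1ℤ (λ v w → x * z * (a v w * c v w) + x * t * (a v w * d v w))
                      (λ v w → y * z * (b v w * c v w) + y * t * (b v w * d v w)) ⟩
  1ℤ * sum₂ (λ v w → x * z * (a v w * c v w) + x * t * (a v w * d v w))
  + 1ℤ * sum₂ (λ v w → y * z * (b v w * c v w) + y * t * (b v w * d v w))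
    ≡⟨ cong₂ _+_
         (trans (ℤ.*-identityˡ _)
           (sum₂-lin (x * z) (x * t) (λ v w → a v w * c v w) (λ v w → a v w * d v w)))
         (trans (ℤ.*-identityˡ _)
           (sum₂-lin (y * z) (y * t) (λ v w → b v w * c v w) (λ v w → b v w * d v w))) ⟩
  x * z * ⟪ a , c ⟫ + x * t * ⟪ a , d ⟫ + (y * z * ⟪ b , c ⟫ + y * t * ⟪ b , d ⟫) ∎
  where
  open ≡-Reasoning
  expand : ∀ x y z t a b c d →
           (x * a + y * b) * (z * c + t * d)
           ≡ 1ℤ * (x * z * (a * c) + x * t * (a * d)) + 1ℤ * (y * z * (b * c) + y * t * (b * d))
  expand = solve-∀

-- With y = Σᵢ rᵢ(p,q) rᵢ and S = y(p,q) = Σᵢ rᵢ(p,q)², orthogonality gives S² ≤ ⟪ y , y ⟫ = c S.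
bessel : ∀ {N n} (r : Fin N → Matrix n) {c} → 0ℤ ≤ c →
         (∀ i j → ⟪ r i , r j ⟫ ≡ c * δ i j) →
         ∀ p q → ∑[ i < N ] (r i p q * r i p q) ≤ c
bessel {N} {n} r {c} 0≤c orth p q = S≤c S refl S*S≤c*S
  where
  s : Fin N → ℤ
  s i = r i p q

  S : ℤ
  S = ∑[ i < N ] (s i * s i)

  y : Matrix n
  y v w = ∑[ i < N ] (s i * r i v w)

  ⟪y,-⟫ : ∀ b → ⟪ y , b ⟫ ≡ ∑[ i < N ] (s i * ⟪ r i , b ⟫)
  ⟪y,-⟫ b = begin
    ∑[ v < n ] ∑[ w < n ] (y v w * b v w)
      ≡⟨ sum₂-cong (λ v w → *-distribʳ-sum (b v w) (λ i → s i * r i v w)) ⟩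
    ∑[ v < n ] ∑[ w < n ] ∑[ i < N ] (s i * r i v w * b v w)
      ≡⟨ sum-cong-≗ (λ v → ∑-comm (λ w i → s i * r i v w * b v w)) ⟩
    ∑[ v < n ] ∑[ i < N ] ∑[ w < n ] (s i * r i v w * b v w)
      ≡⟨ ∑-comm (λ v i → ∑[ w < n ] (s i * r i v w * b v w)) ⟩
    ∑[ i < N ] sum₂ (λ v w → s i * r i v w * b v w)
      ≡⟨ sum-cong-≗ (λ i → trans
           (sum₂-cong (λ v w → ℤ.*-assoc (s i) (r i v w) (b v w)))
           (sum₂-scale (s i) (λ v w → r i v w * b v w))) ⟩
    ∑[ i < N ] (s i * ⟪ r i , b ⟫) ∎
    where open ≡-Reasoning

  ⟪r,y⟫ : ∀ i → ⟪ r i , y ⟫ ≡ c * s i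
  ⟪r,y⟫ i = begin
    ⟪ r i , y ⟫                                    ≡⟨ ⟪⟫-comm (r i) y ⟩
    ⟪ y , r i ⟫                                    ≡⟨ ⟪y,-⟫ (r i) ⟩
    ∑[ j < N ] (s j * ⟪ r j , r i ⟫)               ≡⟨ sum-cong-≗ (λ j → cong (s j *_)
                                                       (trans (⟪⟫-comm (r j) (r i)) (orth i j))) ⟩
    ∑[ j < N ] (s j * (c * δ i j))                 ≡⟨ sum-cong-≗ (λ j → rearrange (s j) c (δ i j)) ⟩
    ∑[ j < N ] (δ i j * (c * s j))                 ≡⟨ sum-δ i (λ j → c * s j) ⟩
    c * s i                                        ∎
    where
    open ≡-Reasoning
    rearrange : ∀ s c d → s * (c * d) ≡ d * (c * s)
    rearrange = solve-∀

  ⟪y,y⟫ : ⟪ y , y ⟫ ≡ c * S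
  ⟪y,y⟫ = begin
    ⟪ y , y ⟫                         ≡⟨ ⟪y,-⟫ y ⟩
    ∑[ i < N ] (s i * ⟪ r i , y ⟫)    ≡⟨ sum-cong-≗ (λ i →
                                           trans (cong (s i *_) (⟪r,y⟫ i)) (rearrange (s i) c)) ⟩
    ∑[ i < N ] (c * (s i * s i))      ≡⟨ *-distribˡ-sum c (λ i → s i * s i) ⟨
    c * S                             ∎
    where
    open ≡-Reasoning
    rearrange : ∀ s c → s * (c * s) ≡ c * (s * s)
    rearrange = solve-∀

  -- `S` is itself the entry `y p q`, so `S * S` is one of the nonnegative terms of `⟪ y , y ⟫`.
  S*S≤c*S : S * S ≤ c * S
  S*S≤c*S = subst (S * S ≤_) ⟪y,y⟫ (term≤sum₂ (λ v w → i*i≥0 (y v w)) p q)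

  S≥0 : 0ℤ ≤ S
  S≥0 = sum-nonNeg (λ i → i*i≥0 (s i))

  -- `S` is a sum and cannot be matched on, so its sign is examined through the copy `T`. When it is
  -- zero nothing can be cancelled, and `0≤c` decides.
  S≤c : ∀ T → T ≡ S → T * T ≤ c * T → S ≤ c
  S≤c (+ zero)   eq _ = subst (_≤ c) eq 0≤c
  S≤c +[1+ k ]   eq h = subst (_≤ c) eq (ℤ.*-cancelʳ-≤-pos +[1+ k ] c +[1+ k ] h)
  S≤c (-[1+ k ]) eq _ = contradiction (subst (0ℤ ≤_) (sym eq) S≥0) λ()

-- Chains of a simple graph

sum₂-transpose : ∀ {n} (a : Matrix n) → sum₂ (λ v w → a w v) ≡ sum₂ a
sum₂-transpose a = ∑-comm (λ v w → a w v)

-- The oriented edge as an antisymmetric matrix: for v ≠ w, it is 1 at (v, w), -1 at (w, v) and 0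
-- elsewhere.
edge : ∀ {n} → Fin n → Fin n → Matrix n
edge v w p q = δ v p * δ w q - δ w p * δ v q

⟪edge⟫ : ∀ {n} (v w : Fin n) (b : Matrix n) → ⟪ edge v w , b ⟫ ≡ b v w - b w v
⟪edge⟫ {n} v w b = begin
  ⟪ edge v w , b ⟫
    ≡⟨ sum₂-cong (λ p q → expand (δ v p) (δ w q) (δ w p) (δ v q) (b p q)) ⟩
  sum₂ (λ p q → 1ℤ * (δ v p * (δ w q * b p q)) + -1ℤ * (δ w p * (δ v q * b p q)))
    ≡⟨ sum₂-lin 1ℤ -1ℤ (λ p q → δ v p * (δ w q * b p q)) (λ p q → δ w p * (δ v q * b p q)) ⟩
  1ℤ * sum₂ (λ p q → δ v p * (δ w q * b p q)) + -1ℤ * sum₂ (λ p q → δ w p * (δ v q * b p q))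
    ≡⟨ cong₂ (λ x y → 1ℤ * x + -1ℤ * y) (entry v w) (entry w v) ⟩
  1ℤ * b v w + -1ℤ * b w v
    ≡⟨ collect (b v w) (b w v) ⟩
  b v w - b w v ∎
  where
  open ≡-Reasoning
  expand : ∀ a b c d x → (a * b - c * d) * x ≡ 1ℤ * (a * (b * x)) + -1ℤ * (c * (d * x))
  expand = solve-∀
  collect : ∀ x y → 1ℤ * x + -1ℤ * y ≡ x - y
  collect = solve-∀
  entry : ∀ v w → sum₂ (λ p q → δ v p * (δ w q * b p q)) ≡ b v w
  entry v w = trans
    (sum-cong-≗ (λ p → trans (sym (*-distribˡ-sum (δ v p) (λ q → δ w q * b p q)))
                             (cong (δ v p *_) (sum-δ w (b p)))))
    (sum-δ v (λ p → b p w))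

edge-norm : ∀ {n} {v w : Fin n} → v ≢ w → ⟪ edge v w , edge v w ⟫ ≡ + 2
edge-norm {v = v} {w} v≢w = trans (⟪edge⟫ v w (edge v w)) (cong₂ _-_ (trans
    (cong₂ _-_ (cong₂ _*_ (δ-diag v) (δ-diag w)) (cong₂ _*_ (δ-off (v≢w ∘ sym)) (δ-off v≢w))) refl)
    (cong₂ _-_ (cong₂ _*_ (δ-off v≢w) (δ-off (v≢w ∘ sym))) (cong₂ _*_ (δ-diag w) (δ-diag v))))

module Chains (G : Graph) (simple : IsSimple G) where
  open Graph G

  -- `∂ (grad f)` unfolds to `div G f`: the Laplacian is the composite of the two operators, and
  -- later proofs use this silently.
  grad : (Vertex → ℤ) → Matrix order
  grad f v w = + mult v w * (f v - f w)

  ∂ : Matrix order → Divisor G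
  ∂ b v = ∑[ w < order ] b v w

  -- As `mult` is 0 or 1 in a simple graph, `supported` says that b vanishes off the edges, in a
  -- form that rewrites directly inside sums.
  record IsChain (b : Matrix order) : Set where
    field
      antisym   : ∀ v w → b w v ≡ - b v w
      supported : ∀ v w → + mult v w * b v w ≡ b v w
  open IsChain

  ∂-lin : ∀ x y a b v → ∂ (λ v w → x * a v w + y * b v w) v ≡ x * ∂ a v + y * ∂ b v
  ∂-lin x y a b v = sum-lin x y (a v) (b v)

  grad-lin : ∀ x y f g v w →
             grad (λ u → x * f u + y * g u) v w ≡ x * grad f v w + y * grad g v w
  grad-lin x y f g v w = lemma x y (+ mult v w) (f v) (f w) (g v) (g w)
    where
    lemma : ∀ x y m a b c d →
            m * ((x * a + y * c) - (x * b + y * d)) ≡ x * (m * (a - b)) + y * (m * (c - d))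
    lemma = solve-∀

  div-lin : ∀ x y f g v →
            div G (λ u → x * f u + y * g u) v ≡ x * div G f v + y * div G g v
  div-lin x y f g v =
    trans (sum-cong-≗ (grad-lin x y f g v)) (∂-lin x y (grad f) (grad g) v)

  mult-idem : ∀ v w → + mult v w * + mult v w ≡ + mult v w
  mult-idem v w with mult v w | simple v w
  ... | 0 | _ = refl
  ... | 1 | _ = refl
  ... | suc (suc _) | s≤s ()

  adjacent⇒mult≡1 : ∀ {v w} → Adjacent v w → mult v w ≡ 1
  adjacent⇒mult≡1 {v} {w} v~w with mult v w | simple v w
  adjacent⇒mult≡1 () | 0 | _
  ... | 1 | _ = refl
  ... | suc (suc _) | s≤s ()

  grad-isChain : ∀ f → IsChain (grad f)
  grad-isChain f .antisym v w =
    trans (cong (λ m → + m * (f w - f v)) (symmetric w v)) (lemma (+ mult v w) (f v) (f w))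
    where
    lemma : ∀ m a b → m * (b - a) ≡ - (m * (a - b))
    lemma = solve-∀
  grad-isChain f .supported v w =
    trans (sym (ℤ.*-assoc (+ mult v w) (+ mult v w) (f v - f w)))
          (cong (_* (f v - f w)) (mult-idem v w))

  lin-isChain : ∀ x y {a b} → IsChain a → IsChain b → IsChain (λ v w → x * a v w + y * b v w)
  lin-isChain x y {a} {b} A B .antisym v w =
    trans (cong₂ (λ s t → x * s + y * t) (antisym A v w) (antisym B v w))
          (lemma x y (a v w) (b v w))
    where
    lemma : ∀ x y a b → x * - a + y * - b ≡ - (x * a + y * b)
    lemma = solve-∀
  lin-isChain x y {a} {b} A B .supported v w =
    trans (lemma x y (+ mult v w) (a v w) (b v w))
          (cong₂ (λ s t → x * s + y * t) (supported A v w) (supported B v w))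
    where
    lemma : ∀ x y m a b → m * (x * a + y * b) ≡ x * (m * a) + y * (m * b)
    lemma = solve-∀

  -- Summation by parts: antisymmetry turns `- f w * b v w` into `f w * b w v`, and transposing the
  -- double sum makes both halves equal. So `grad` is adjoint to `∂`, with each edge counted twice.
  ⟪grad⟫ : ∀ f {b} → IsChain b → ⟪ grad f , b ⟫ ≡ + 2 * ∑[ v < order ] (f v * ∂ b v)
  ⟪grad⟫ f {b} B = begin
    ⟪ grad f , b ⟫
      ≡⟨ sum₂-cong pointwise ⟩
    sum₂ (λ v w → 1ℤ * (f v * b v w) + 1ℤ * (f w * b w v))
      ≡⟨ sum₂-lin 1ℤ 1ℤ (λ v w → f v * b v w) (λ v w → f w * b w v) ⟩
    1ℤ * sum₂ (λ v w → f v * b v w) + 1ℤ * sum₂ (λ v w → f w * b w v)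
      ≡⟨ cong (λ x → 1ℤ * sum₂ (λ v w → f v * b v w) + 1ℤ * x)
              (sum₂-transpose (λ v w → f v * b v w)) ⟩
    1ℤ * sum₂ (λ v w → f v * b v w) + 1ℤ * sum₂ (λ v w → f v * b v w)
      ≡⟨ double (sum₂ (λ v w → f v * b v w)) ⟩
    + 2 * sum₂ (λ v w → f v * b v w)
      ≡⟨ cong (+ 2 *_) (sum-cong-≗ (λ v → *-distribˡ-sum (f v) (b v))) ⟨
    + 2 * ∑[ v < order ] (f v * ∂ b v) ∎
    where
    open ≡-Reasoning
    double : ∀ x → 1ℤ * x + 1ℤ * x ≡ + 2 * x
    double = solve-∀
    assoc : ∀ m x y b → m * (x - y) * b ≡ (x - y) * (m * b)
    assoc = solve-∀
    split : ∀ x y b → (x - y) * b ≡ 1ℤ * (x * b) + 1ℤ * (y * - b)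
    split = solve-∀
    pointwise : ∀ v w → grad f v w * b v w ≡ 1ℤ * (f v * b v w) + 1ℤ * (f w * b w v)
    pointwise v w = begin
      grad f v w * b v w                             ≡⟨ assoc (+ mult v w) (f v) (f w) (b v w) ⟩
      (f v - f w) * (+ mult v w * b v w)             ≡⟨ cong ((f v - f w) *_) (supported B v w) ⟩
      (f v - f w) * b v w                            ≡⟨ split (f v) (f w) (b v w) ⟩
      1ℤ * (f v * b v w) + 1ℤ * (f w * - b v w)      ≡⟨ cong (λ x → 1ℤ * (f v * b v w) + 1ℤ * (f w * x))
                                                             (antisym B v w) ⟨
      1ℤ * (f v * b v w) + 1ℤ * (f w * b w v)        ∎

  -- By adjointness the energy `⟪ grad f , grad f ⟫` is twice the sum of `f v * div G f v`, hence
  -- zero.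
  div≡0⇒grad≡0 : ∀ f → (∀ v → div G f v ≡ 0ℤ) → ∀ v w → grad f v w ≡ 0ℤ
  div≡0⇒grad≡0 f harmonic = ⟪a,a⟫≡0⇒a≡0 (grad f) (begin
    ⟪ grad f , grad f ⟫                    ≡⟨ ⟪grad⟫ f (grad-isChain f) ⟩
    + 2 * ∑[ v < order ] (f v * div G f v) ≡⟨ cong (+ 2 *_) (sum-cong-≗ (λ v →
                                                trans (cong (f v *_) (harmonic v)) (ℤ.*-zeroʳ (f v)))) ⟩
    + 2 * ∑[ v < order ] 0ℤ                ≡⟨ cong (+ 2 *_) (sum-replicate-zero order) ⟩
    0ℤ                                     ∎)
    where open ≡-Reasoning

  edge-isChain : ∀ {v w} → Adjacent v w → IsChain (edge v w)
  edge-isChain {v} {w} v~w .antisym p q = lemma (δ v p) (δ w q) (δ w p) (δ v q)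
    where
    lemma : ∀ a b c d → d * c - b * a ≡ - (a * b - c * d)
    lemma = solve-∀
  edge-isChain {v} {w} v~w .supported p q = begin
    + mult p q * (δ v p * δ w q - δ w p * δ v q)
      ≡⟨ expand (+ mult p q) (δ v p) (δ w q) (δ w p) (δ v q) ⟩
    δ v p * + mult p q * δ w q - δ w p * + mult p q * δ v q
      ≡⟨ cong₂ _-_ (at v w v~w) (at w v (subst (0 ℕ.<_) (symmetric v w) v~w)) ⟩
    δ v p * δ w q - δ w p * δ v q ∎
    where
    open ≡-Reasoning
    expand : ∀ m a b c d → m * (a * b - c * d) ≡ a * m * b - c * m * d
    expand = solve-∀
    swap : ∀ a m b → a * m * b ≡ a * (b * m)
    swap = solve-∀
    -- The deltas vanish unless p = v and q = w, and there the multiplicity is 1.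
    at : ∀ v w → Adjacent v w → δ v p * + mult p q * δ w q ≡ δ v p * δ w q
    at v w v~w = begin
      δ v p * + mult p q * δ w q    ≡⟨ cong (_* δ w q) (δ-subst v p (λ p → + mult p q)) ⟩
      δ v p * + mult v q * δ w q    ≡⟨ swap (δ v p) (+ mult v q) (δ w q) ⟩
      δ v p * (δ w q * + mult v q)  ≡⟨ cong (δ v p *_) (δ-subst w q (λ q → + mult v q)) ⟩
      δ v p * (δ w q * + mult v w)  ≡⟨ cong (λ m → δ v p * (δ w q * + m)) (adjacent⇒mult≡1 v~w) ⟩
      δ v p * (δ w q * 1ℤ)          ≡⟨ cong (δ v p *_) (ℤ.*-identityʳ (δ w q)) ⟩
      δ v p * δ w q                 ∎

  ∂-edge : ∀ v w p → ∂ (edge v w) p ≡ δ v p - δ w p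
  ∂-edge v w p = begin
    ∂ (edge v w) p                                  ≡⟨ sum-cong-≗ (λ q → cong (_+_ (δ v p * δ w q))
                                                         (ℤ.neg-distribˡ-* (δ w p) (δ v q))) ⟩
    ∑[ q < order ] (δ v p * δ w q + - δ w p * δ v q) ≡⟨ sum-lin (δ v p) (- δ w p) (δ w) (δ v) ⟩
    δ v p * sum (δ w) + - δ w p * sum (δ v)          ≡⟨ cong₂ (λ x y → δ v p * x + - δ w p * y)
                                                              (sum-δ-1 w) (sum-δ-1 v) ⟩
    δ v p * 1ℤ + - δ w p * 1ℤ                        ≡⟨ cong₂ _+_ (ℤ.*-identityʳ (δ v p))
                                                              (ℤ.*-identityʳ (- δ w p)) ⟩
    δ v p - δ w p                                    ∎
    where open ≡-Reasoning

  adjacent⇒≢ : ∀ {v w} → Adjacent v w → v ≢ w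
  adjacent⇒≢ {v} v~v refl = contradiction (subst (0 ℕ.<_) (loopless v) v~v) λ()

  -- With a second edge e′ parallel to e, the chain β = e′ would be another solution.
  module _ {v w} (v~w : Adjacent v w) {β} (B : ∀ p q → β q p ≡ - β p q)
           (norm : ⟪ β , β ⟫ ≡ + 2) (∂β : ∀ p → ∂ β p ≡ δ v p - δ w p) where
    private
      v≢w : v ≢ w
      v≢w = adjacent⇒≢ v~w

      s : Vertex → ℤ
      s p = δ v p - δ w p

      sv≡1 : s v ≡ 1ℤ
      sv≡1 = cong₂ _-_ (δ-diag v) (δ-off (v≢w ∘ sym))

      sw≡-1 : s w ≡ -1ℤ
      sw≡-1 = cong₂ _-_ (δ-off v≢w) (δ-diag w)

      s-off : ∀ {p} → p ≢ v → p ≢ w → s p ≡ 0ℤ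
      s-off p≢v p≢w = cong₂ _-_ (δ-off (p≢v ∘ sym)) (δ-off (p≢w ∘ sym))

      s-cases : ∀ p → s p ≡ 1ℤ ⊎ s p ≡ -1ℤ ⊎ s p ≡ 0ℤ
      s-cases p with p Fin.≟ v | p Fin.≟ w
      ... | yes refl | _        = inj₁ sv≡1
      ... | no _     | yes refl = inj₂ (inj₁ sw≡-1)
      ... | no p≢v   | no p≢w   = inj₂ (inj₂ (s-off p≢v p≢w))

      T : Matrix order
      T p q = 1ℤ * (β p q * β p q) + -1ℤ * (s p * β p q)

      0≤T′ : ∀ x σ → σ ≡ 1ℤ ⊎ σ ≡ -1ℤ ⊎ σ ≡ 0ℤ → 0ℤ ≤ 1ℤ * (x * x) + -1ℤ * (σ * x)
      0≤T′ x σ c = subst (0ℤ ≤_) (sym (expand x σ)) (go x σ c)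
        where
        expand : ∀ x σ → 1ℤ * (x * x) + -1ℤ * (σ * x) ≡ x * (x - σ)
        expand = solve-∀
        go : ∀ x σ → σ ≡ 1ℤ ⊎ σ ≡ -1ℤ ⊎ σ ≡ 0ℤ → 0ℤ ≤ x * (x - σ)
        go (+ 0)           _ (inj₁ refl)        = +≤+ z≤n
        go +[1+ n ]        _ (inj₁ refl)        = subst (0ℤ ≤_) (ℤ.pos-* (suc n) n) (+≤+ z≤n)
        go (-[1+ n ])      _ (inj₁ refl)        = +≤+ z≤n
        go (+ n)           _ (inj₂ (inj₁ refl)) = subst (0ℤ ≤_) (ℤ.pos-* n (n ℕ.+ 1)) (+≤+ z≤n)
        go (-[1+ 0 ])      _ (inj₂ (inj₁ refl)) = +≤+ z≤n
        go (-[1+ suc n ])  _ (inj₂ (inj₁ refl)) = +≤+ z≤n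
        go x               _ (inj₂ (inj₂ refl)) = subst (λ y → 0ℤ ≤ x * y) (sym (ℤ.+-identityʳ x)) (i*i≥0 x)

      ∑T≡0 : sum₂ T ≡ 0ℤ
      ∑T≡0 = begin
        sum₂ T
          ≡⟨ sum₂-lin 1ℤ -1ℤ (λ p q → β p q * β p q) (λ p q → s p * β p q) ⟩
        1ℤ * ⟪ β , β ⟫ + -1ℤ * sum₂ (λ p q → s p * β p q)
          ≡⟨ cong₂ (λ x y → 1ℤ * x + -1ℤ * y) norm
               (sum-cong-≗ (λ p → trans (sym (*-distribˡ-sum (s p) (β p))) (cong (s p *_) (∂β p)))) ⟩
        1ℤ * + 2 + -1ℤ * ∑[ p < order ] (s p * s p)
          ≡⟨ cong (λ x → 1ℤ * + 2 + -1ℤ * x) (begin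
               ∑[ p < order ] (s p * s p)
                 ≡⟨ sum-cong-≗ (λ p → expand (δ v p) (δ w p) (s p)) ⟩
               ∑[ p < order ] (1ℤ * (δ v p * s p) + -1ℤ * (δ w p * s p))
                 ≡⟨ sum-lin 1ℤ -1ℤ (λ p → δ v p * s p) (λ p → δ w p * s p) ⟩
               1ℤ * ∑[ p < order ] (δ v p * s p) + -1ℤ * ∑[ p < order ] (δ w p * s p)
                 ≡⟨ cong₂ (λ x y → 1ℤ * x + -1ℤ * y) (trans (sum-δ v s) sv≡1) (trans (sum-δ w s) sw≡-1) ⟩
               + 2 ∎) ⟩
        0ℤ ∎
        where
        open ≡-Reasoning
        expand : ∀ a b s → (a - b) * s ≡ 1ℤ * (a * s) + -1ℤ * (b * s)
        expand = solve-∀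

      -- Nonnegative entries with zero sum vanish, so `T p q` is zero; in a row with `s p` zero it
      -- is the square of `β p q`.
      β-row : ∀ {p} → s p ≡ 0ℤ → ∀ q → β p q ≡ 0ℤ
      β-row {p} sp≡0 q = i*i≡0⇒i≡0 (begin
        β p q * β p q ≡⟨ expand (β p q) ⟩
        1ℤ * (β p q * β p q) + -1ℤ * (0ℤ * β p q)
          ≡⟨ cong (λ x → 1ℤ * (β p q * β p q) + -1ℤ * (x * β p q)) sp≡0 ⟨
        T p q ≡⟨ sum₂≡0⇒≡0 (λ p q → 0≤T′ (β p q) (s p) (s-cases p)) ∑T≡0 p q ⟩
        0ℤ ∎)
        where
        open ≡-Reasoning
        expand : ∀ x → x * x ≡ 1ℤ * (x * x) + -1ℤ * (0ℤ * x)
        expand = solve-∀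

      -- Row v is concentrated at w: the diagonal entry vanishes by antisymmetry, and for q other
      -- than v and w the entry is minus one in the zero row q.
      β-row-v : ∀ q → β v q ≡ δ w q * β v q
      β-row-v q with q Fin.≟ w | q Fin.≟ v
      ... | yes refl | _        = sym (trans (cong (_* β v w) (δ-diag w)) (ℤ.*-identityˡ (β v w)))
      ... | no q≢w   | yes refl = trans βvv≡0 (sym (trans (cong (δ w v *_) βvv≡0) (ℤ.*-zeroʳ (δ w v))))
        where
        βvv≡0 : β v v ≡ 0ℤ
        βvv≡0 = i≡-i⇒i≡0 (B v v)
      ... | no q≢w   | no q≢v   =
        trans (trans (B q v) (cong -_ (β-row (s-off q≢v q≢w) v)))
              (sym (cong (_* β v q) (δ-off (q≢w ∘ sym))))

      βvw≡1 : β v w ≡ 1ℤ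
      βvw≡1 = begin
        β v w                              ≡⟨ sum-δ w (β v) ⟨
        ∑[ q < order ] (δ w q * β v q)     ≡⟨ sum-cong-≗ β-row-v ⟨
        ∂ β v                              ≡⟨ ∂β v ⟩
        s v                                ≡⟨ sv≡1 ⟩
        1ℤ                                 ∎
        where open ≡-Reasoning

      ⟪edge,β⟫ : ⟪ edge v w , β ⟫ ≡ + 2
      ⟪edge,β⟫ = trans (⟪edge⟫ v w β)
        (cong₂ _-_ βvw≡1 (trans (B v w) (cong -_ βvw≡1)))

    -- The boundary at v forces `β v w` to be 1, so β has inner product 2 with the edge. The squared
    -- norm of the difference is then 2 - 2 - 2 + 2 = 0.
    norm2∧∂≡⇒edge : ∀ p q → β p q ≡ edge v w p q
    norm2∧∂≡⇒edge p q = ℤ.i-j≡0⇒i≡j (β p q) (edge v w p q)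
      (trans (expand (β p q) (edge v w p q))
             (⟪a,a⟫≡0⇒a≡0 (λ p q → 1ℤ * β p q + -1ℤ * edge v w p q) (begin
        ⟪ (λ p q → 1ℤ * β p q + -1ℤ * edge v w p q) , (λ p q → 1ℤ * β p q + -1ℤ * edge v w p q) ⟫
          ≡⟨ ⟪⟫-lin 1ℤ -1ℤ 1ℤ -1ℤ β (edge v w) β (edge v w) ⟩
        1ℤ * ⟪ β , β ⟫ + -1ℤ * ⟪ β , edge v w ⟫ + (-1ℤ * ⟪ edge v w , β ⟫ + 1ℤ * ⟪ edge v w , edge v w ⟫)
          ≡⟨ cong₂ _+_ (cong₂ (λ x y → 1ℤ * x + -1ℤ * y) norm (trans (⟪⟫-comm β (edge v w)) ⟪edge,β⟫))
                       (cong₂ (λ x y → -1ℤ * x + 1ℤ * y) ⟪edge,β⟫ (edge-norm v≢w)) ⟩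
        0ℤ ∎) p q))
      where
      open ≡-Reasoning
      expand : ∀ x y → x - y ≡ 1ℤ * x + -1ℤ * y
      expand = solve-∀

  -- If div f = M ∂a then grad f is M times the orthogonal projection of a
  -- onto the cut space, so reflect is M times the reflection in that space.
  module Reflection (M : ℤ) where

    reflect : (Vertex → ℤ) → Matrix order → Matrix order
    reflect f a v w = + 2 * grad f v w + - M * a v w

    -- Both `M * ⟪ grad f , b ⟫` and `M * ⟪ a , grad g ⟫` equal `⟪ grad f , grad g ⟫`, so all terms
    -- but the last cancel in the expansion.
    reflect-isometry : ∀ {f g a b} → IsChain a → IsChain b →
                       (∀ v → div G f v ≡ M * ∂ a v) → (∀ v → div G g v ≡ M * ∂ b v) →
                       ⟪ reflect f a , reflect g b ⟫ ≡ M * M * ⟪ a , b ⟫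
    reflect-isometry {f} {g} {a} {b} A B df dg = begin
      ⟪ reflect f a , reflect g b ⟫
        ≡⟨ ⟪⟫-lin (+ 2) (- M) (+ 2) (- M) (grad f) a (grad g) b ⟩
      + 2 * + 2 * X + + 2 * - M * ⟪ grad f , b ⟫ + (- M * + 2 * ⟪ a , grad g ⟫ + - M * - M * ⟪ a , b ⟫)
        ≡⟨ collect M X ⟪ grad f , b ⟫ ⟪ a , grad g ⟫ ⟪ a , b ⟫ ⟩
      + 4 * X - + 2 * (M * ⟪ grad f , b ⟫) - + 2 * (M * ⟪ a , grad g ⟫) + M * M * ⟪ a , b ⟫
        ≡⟨ cong₂ (λ x y → + 4 * X - + 2 * x - + 2 * y + M * M * ⟪ a , b ⟫)
                 (sym (project f g B dg))
                 (trans (cong (M *_) (⟪⟫-comm a (grad g)))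
                        (trans (sym (project g f A df)) (⟪⟫-comm (grad g) (grad f)))) ⟩
      + 4 * X - + 2 * X - + 2 * X + M * M * ⟪ a , b ⟫
        ≡⟨ cancel X (M * M * ⟪ a , b ⟫) ⟩
      M * M * ⟪ a , b ⟫ ∎
      where
      open ≡-Reasoning
      X = ⟪ grad f , grad g ⟫
      collect : ∀ m x y z w →
                + 2 * + 2 * x + + 2 * - m * y + (- m * + 2 * z + - m * - m * w)
                ≡ + 4 * x - + 2 * (m * y) - + 2 * (m * z) + m * m * w
      collect = solve-∀
      cancel : ∀ x y → + 4 * x - + 2 * x - + 2 * x + y ≡ y
      cancel = solve-∀
      rearrange : ∀ x m y → x * (m * y) ≡ m * (x * y)
      rearrange = solve-∀
      -- Pairing with a gradient sees only the boundary of a chain, and `grad g` has the boundary of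
      -- M b.
      project : ∀ f g {b} → IsChain b → (∀ v → div G g v ≡ M * ∂ b v) →
                ⟪ grad f , grad g ⟫ ≡ M * ⟪ grad f , b ⟫
      project f g {b} B dg = begin
        ⟪ grad f , grad g ⟫                            ≡⟨ ⟪grad⟫ f (grad-isChain g) ⟩
        + 2 * ∑[ v < order ] (f v * div G g v)         ≡⟨ cong (+ 2 *_) (sum-cong-≗ (λ v →
                                                            trans (cong (f v *_) (dg v)) (rearrange (f v) M (∂ b v)))) ⟩
        + 2 * ∑[ v < order ] (M * (f v * ∂ b v))       ≡⟨ cong (+ 2 *_) (*-distribˡ-sum M (λ v → f v * ∂ b v)) ⟨
        + 2 * (M * ∑[ v < order ] (f v * ∂ b v))       ≡⟨ rearrange (+ 2) M _ ⟩
        M * (+ 2 * ∑[ v < order ] (f v * ∂ b v))       ≡⟨ cong (M *_) (⟪grad⟫ f B) ⟨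
        M * ⟪ grad f , b ⟫                             ∎

    -- The function h = 2f - 2f′ - Mg is harmonic, so its gradient is zero and 2 grad f - 2 grad f′
    -- = M grad g. The difference of the reflections is therefore M (grad g - a + a′). Taking a = a′
    -- and g = 0 shows that the choice of potential does not matter modulo M.
    reflect-cong : ∀ {f f′ g a a′} →
                   (∀ v → div G f v ≡ M * ∂ a v) → (∀ v → div G f′ v ≡ M * ∂ a′ v) →
                   (∀ v → + 2 * ∂ a v - + 2 * ∂ a′ v ≡ div G g v) →
                   ∀ v w → M ∣ reflect f a v w - reflect f′ a′ v w
    reflect-cong {f} {f′} {g} {a} {a′} df df′ dg v w =
      divides (grad g v w - a v w + a′ v w) (begin
        reflect f a v w - reflect f′ a′ v w
          ≡⟨ isolate M (grad f v w) (grad f′ v w) (grad g v w) (a v w) (a′ v w) ⟩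
        (+ 2 * grad f v w + -1ℤ * (+ 2 * grad f′ v w + M * grad g v w))
        + (grad g v w - a v w + a′ v w) * M
          ≡⟨ cong (_+ (grad g v w - a v w + a′ v w) * M) grad-h ⟩
        0ℤ + (grad g v w - a v w + a′ v w) * M
          ≡⟨ ℤ.+-identityˡ _ ⟩
        (grad g v w - a v w + a′ v w) * M ∎)
      where
      open ≡-Reasoning
      k h : Vertex → ℤ
      k u = + 2 * f′ u + M * g u
      h u = + 2 * f u + -1ℤ * k u
      isolate : ∀ m f f′ g a a′ →
                (+ 2 * f + - m * a) - (+ 2 * f′ + - m * a′)
                ≡ (+ 2 * f + -1ℤ * (+ 2 * f′ + m * g)) + (g - a + a′) * m
      isolate = solve-∀
      vanish : ∀ m a a′ → + 2 * (m * a) + -1ℤ * (+ 2 * (m * a′) + m * (+ 2 * a - + 2 * a′)) ≡ 0ℤ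
      vanish = solve-∀
      div-h : ∀ u → div G h u ≡ 0ℤ
      div-h u = begin
        div G h u
          ≡⟨ div-lin (+ 2) -1ℤ f k u ⟩
        + 2 * div G f u + -1ℤ * div G k u
          ≡⟨ cong (λ x → + 2 * div G f u + -1ℤ * x) (div-lin (+ 2) M f′ g u) ⟩
        + 2 * div G f u + -1ℤ * (+ 2 * div G f′ u + M * div G g u)
          ≡⟨ cong₂ (λ x y → + 2 * x + -1ℤ * y) (df u)
                   (cong₂ (λ x y → + 2 * x + M * y) (df′ u) (sym (dg u))) ⟩
        + 2 * (M * ∂ a u) + -1ℤ * (+ 2 * (M * ∂ a′ u) + M * (+ 2 * ∂ a u - + 2 * ∂ a′ u))
          ≡⟨ vanish M (∂ a u) (∂ a′ u) ⟩
        0ℤ ∎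
      grad-h : + 2 * grad f v w + -1ℤ * (+ 2 * grad f′ v w + M * grad g v w) ≡ 0ℤ
      grad-h = begin
        + 2 * grad f v w + -1ℤ * (+ 2 * grad f′ v w + M * grad g v w)
          ≡⟨ cong (λ x → + 2 * grad f v w + -1ℤ * x) (grad-lin (+ 2) M f′ g v w) ⟨
        + 2 * grad f v w + -1ℤ * grad k v w
          ≡⟨ grad-lin (+ 2) -1ℤ f k v w ⟨
        grad h v w
          ≡⟨ div≡0⇒grad≡0 h div-h v w ⟩
        0ℤ ∎

    reflect-isChain : ∀ f {a} → IsChain a → IsChain (reflect f a)
    reflect-isChain f A = lin-isChain (+ 2) (- M) (grad-isChain f) A

    -- Reflection in the cut space alters a chain only by a cycle; here 2M ∂a - M ∂a = M ∂a.
    ∂-reflect : ∀ {f a} → (∀ v → div G f v ≡ M * ∂ a v) → ∀ v → ∂ (reflect f a) v ≡ M * ∂ a v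
    ∂-reflect {f} {a} df v =
      trans (∂-lin (+ 2) (- M) (grad f) a v)
            (trans (cong (λ x → + 2 * x + - M * ∂ a v) (df v)) (lemma M (∂ a v)))
      where
      lemma : ∀ m a → + 2 * (m * a) + - m * a ≡ m * a
      lemma = solve-∀

    module _ .{{_ : NonZero M}} where

      -- Divisibility along edges spreads along paths, so M divides all differences of values of f.
      -- With base vertex q, g = (f - f(q)) / M is integral and has divergence `∂ a`.
      grad∣⇒div : ∀ {f a} → (∀ v → div G f v ≡ M * ∂ a v) →
                  (∀ v w → M ∣ grad f v w) → Vertex → ∃[ g ] (∀ v → ∂ a v ≡ div G g v)
      grad∣⇒div {f} {a} df M∣grad q = g , λ v → ℤ.*-cancelˡ-≡ M (∂ a v) (div G g v) (begin
        M * ∂ a v                           ≡⟨ df v ⟨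
        div G f v                           ≡⟨ sum-cong-≗ (λ w → step (+ mult v w) (f v) (f w) (f q)
                                                 (g v) (g w) (equality (M∣f-f v q)) (equality (M∣f-f w q))) ⟩
        ∑[ w < order ] (M * grad g v w)     ≡⟨ *-distribˡ-sum M (grad g v) ⟨
        M * div G g v                       ∎)
        where
        open ≡-Reasoning
        open _∣_
        M∣f-f : ∀ v w → M ∣ f v - f w
        M∣f-f v w = along (connected v w)
          where
          along : ∀ {v} → Star Adjacent v w → M ∣ f v - f w
          along ε = divides 0ℤ (trans (ℤ.i≡j⇒i-j≡0 {f w} refl) (sym (ℤ.*-zeroˡ M)))
          along {v} (_◅_ {j = u} v~u u⋆w) with M∣grad v u | along u⋆w
          ... | divides x eq | divides y eq′ = divides (x + y) (begin
            f v - f w                     ≡⟨ telescope (f v) (f u) (f w) ⟩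
            1ℤ * (f v - f u) + (f u - f w)
              ≡⟨ cong₂ (λ m z → + m * (f v - f u) + z) (sym (adjacent⇒mult≡1 v~u)) eq′ ⟩
            grad f v u + y * M            ≡⟨ cong (_+ y * M) eq ⟩
            x * M + y * M                 ≡⟨ ℤ.*-distribʳ-+ M x y ⟨
            (x + y) * M                   ∎)
            where
            telescope : ∀ a b c → a - c ≡ 1ℤ * (a - b) + (b - c)
            telescope = solve-∀
        g : Vertex → ℤ
        g v = quotient (M∣f-f v q)
        step : ∀ m a b c x y → a - c ≡ x * M → b - c ≡ y * M → m * (a - b) ≡ M * (m * (x - y))
        step m a b c x y p q = begin
          m * (a - b)               ≡⟨ shift m a b c ⟩
          m * ((a - c) - (b - c))   ≡⟨ cong₂ (λ s t → m * (s - t)) p q ⟩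
          m * (x * M - y * M)       ≡⟨ pull m x y M ⟩
          M * (m * (x - y))         ∎
          where
          shift : ∀ m a b c → m * (a - b) ≡ m * ((a - c) - (b - c))
          shift = solve-∀
          pull : ∀ m x y M → m * (x * M - y * M) ≡ M * (m * (x - y))
          pull = solve-∀

      -- The quotient β = r / M inherits antisymmetry from r, norm 2 from the isometry and its
      -- boundary from `∂-reflect`, so it is the edge e. Then 2 grad f = r + M e = 2M e, and
      -- `grad∣⇒div` applies.
      reflect∣⇒div : ∀ {f v w} → Adjacent v w → (∀ p → div G f p ≡ M * ∂ (edge v w) p) →
                     (∀ p q → M ∣ reflect f (edge v w) p q) →
                     ∃[ g ] (∀ p → ∂ (edge v w) p ≡ div G g p)
      reflect∣⇒div {f} {v} {w} v~w df M∣r =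
        grad∣⇒div {f} {edge v w} df (λ p q → divides (edge v w p q)
          (ℤ.*-cancelˡ-≡ (+ 2) (grad f p q) (edge v w p q * M) (begin
            + 2 * grad f p q                               ≡⟨ isolate (grad f p q) M (edge v w p q) ⟩
            r p q + M * edge v w p q                       ≡⟨ cong (_+ M * edge v w p q) (r≡βM p q) ⟩
            β p q * M + M * edge v w p q                   ≡⟨ cong (λ x → x * M + M * edge v w p q) (β≡edge p q) ⟩
            edge v w p q * M + M * edge v w p q            ≡⟨ double (edge v w p q) M ⟩
            + 2 * (edge v w p q * M)                       ∎))) v
        where
        open ≡-Reasoning
        open _∣_
        r β : Matrix order
        r = reflect f (edge v w)
        β p q = quotient (M∣r p q)
        r≡βM : ∀ p q → r p q ≡ β p q * M
        r≡βM p q = equality (M∣r p q)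
        isolate : ∀ x m e → + 2 * x ≡ (+ 2 * x + - m * e) + m * e
        isolate = solve-∀
        double : ∀ e m → e * m + m * e ≡ + 2 * (e * m)
        double = solve-∀
        square : ∀ x m → m * m * (x * x) ≡ (x * m) * (x * m)
        square = solve-∀
        β-antisym : ∀ p q → β q p ≡ - β p q
        β-antisym p q = ℤ.*-cancelʳ-≡ (β q p) (- β p q) M (begin
          β q p * M     ≡⟨ r≡βM q p ⟨
          r q p         ≡⟨ antisym (reflect-isChain f (edge-isChain v~w)) p q ⟩
          - r p q       ≡⟨ cong -_ (r≡βM p q) ⟩
          - (β p q * M) ≡⟨ ℤ.neg-distribˡ-* (β p q) M ⟩
          - β p q * M   ∎)
        β-norm : ⟪ β , β ⟫ ≡ + 2
        β-norm = ℤ.*-cancelˡ-≡ (M * M) ⟪ β , β ⟫ (+ 2) {{ℤ.i*j≢0 M M}} (begin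
          M * M * ⟪ β , β ⟫                            ≡⟨ sum₂-scale (M * M) (λ p q → β p q * β p q) ⟨
          sum₂ (λ p q → M * M * (β p q * β p q))       ≡⟨ sum₂-cong (λ p q → trans (square (β p q) M)
                                                            (sym (cong₂ _*_ (r≡βM p q) (r≡βM p q)))) ⟩
          ⟪ r , r ⟫
            ≡⟨ reflect-isometry {f} {f} (edge-isChain v~w) (edge-isChain v~w) df df ⟩
          M * M * ⟪ edge v w , edge v w ⟫              ≡⟨ cong (M * M *_) (edge-norm (adjacent⇒≢ v~w)) ⟩
          M * M * + 2                                  ∎)
        ∂β : ∀ p → ∂ β p ≡ δ v p - δ w p
        ∂β p = trans (ℤ.*-cancelˡ-≡ M (∂ β p) (∂ (edge v w) p) (begin
          M * ∂ β p                        ≡⟨ *-distribˡ-sum M (β p) ⟩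
          ∑[ q < order ] (M * β p q)       ≡⟨ sum-cong-≗ (λ q → trans (ℤ.*-comm M (β p q)) (sym (r≡βM p q))) ⟩
          ∂ r p                            ≡⟨ ∂-reflect {f} {edge v w} df p ⟩
          M * ∂ (edge v w) p               ∎)) (∂-edge v w p)
        β≡edge : ∀ p q → β p q ≡ edge v w p q
        β≡edge = norm2∧∂≡⇒edge v~w β-antisym β-norm ∂β

-- Packing and pigeonhole arguments

representative : ∀ {N h} (κ : Fin (suc N) → Fin h) →
                 ∃[ ρ ] (∀ i → κ (ρ (κ i)) ≡ κ i)
representative {N} {h} κ = proj₁ ∘ choose , λ i → proj₂ (choose (κ i)) i refl
  where
  choose : ∀ a → ∃[ i ] (∀ i′ → κ i′ ≡ a → κ i ≡ a)
  choose a with Fin.any? (λ i → κ i Fin.≟ a)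
  ... | yes (i , eq) = i , λ _ _ → eq
  -- An empty class takes the default index `zero`, and its condition holds vacuously.
  ... | no none      = zero , λ i′ eq → contradiction (i′ , eq) none

-- Bessel's inequality is applied once per class, at the coordinate of the class representative.
-- Each index contributes a nonzero integer square, at least 1, at the coordinate of its own class,
-- while each of the h coordinates carries at most c in total.
packing : ∀ {N n h} (r : Fin (suc N) → Matrix n) {c} → 0ℤ ≤ c →
          (∀ i j → ⟪ r i , r j ⟫ ≡ c * δ i j) →
          (κ : Fin (suc N) → Fin h) (p q : Fin (suc N) → Fin n) →
          (∀ i j → κ i ≡ κ j → r j (p i) (q i) ≢ 0ℤ) → + suc N ≤ + h * c
packing {N} {n} {h} r {c} 0≤c orth κ p q r≢0 = begin
  + suc N                                       ≡⟨ ℤ.*-identityʳ (+ suc N) ⟨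
  + suc N * 1ℤ                                  ≡⟨ sum-const (suc N) 1ℤ ⟨
  ∑[ _ < suc N ] 1ℤ
    ≤⟨ sum-mono (λ i → ℤ.≤-trans (i≢0⇒1≤i*i (r≢0 (ρ (κ i)) i (κρκ≡κ i)))
                                 (term≤sum (λ a → i*i≥0 (entry i a)) (κ i))) ⟩
  ∑[ i < suc N ] ∑[ a < h ] (entry i a * entry i a)
    ≡⟨ ∑-comm (λ i a → entry i a * entry i a) ⟩
  ∑[ a < h ] ∑[ i < suc N ] (entry i a * entry i a)
    ≤⟨ sum-mono (λ a → bessel r 0≤c orth (p (ρ a)) (q (ρ a))) ⟩
  ∑[ _ < h ] c                                  ≡⟨ sum-const h c ⟩
  + h * c                                       ∎
  where
  open ℤ.≤-Reasoning
  ρ : Fin h → Fin (suc N)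
  ρ = proj₁ (representative κ)
  κρκ≡κ : ∀ i → κ (ρ (κ i)) ≡ κ i
  κρκ≡κ = proj₂ (representative κ)
  entry : Fin (suc N) → Fin h → ℤ
  entry i a = r i (p (ρ a)) (q (ρ a))

-- The pigeonhole principle gives two columns on which all previously chosen
-- elements agree; an element separating them differs from every chosen one.
separating-family : ∀ {X : Set} {b k} .{{_ : ℕ.NonZero b}} (c : X → Fin k → Fin b) →
  (∀ {j j′} → j ≢ j′ → ∃[ x ] c x j ≢ c x j′) →
  ∀ N → b ℕ.^ N ℕ.< k →
  Σ[ e ∈ (Fin N → X) ] (∀ i → ∃₂ λ j j′ → c (e i) j ≢ c (e i) j′)
       × (∀ i i′ → (∀ j → c (e i) j ≡ c (e i′) j) → i ≡ i′)
separating-family c sep zero    _ = (λ ()) , (λ ()) , λ ()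
separating-family {X} {b} {k} c sep (suc N) b^N<k
  with e , nonconst , distinct ←
         separating-family c sep N (ℕ.≤-<-trans (ℕ.m≤n*m (b ℕ.^ N) b) b^N<k)
  -- Read on the N chosen elements, a column is a word of length N over b letters, which `funToFin`
  -- codes as a number below `b ^ N`.
  with j , j′ , j<j′ , eq ←
         Fin.pigeonhole (ℕ.≤-<-trans (ℕ.m≤n*m (b ℕ.^ N) b) b^N<k)
                        (λ j → funToFin {N} {b} (λ i → c (e i) j))
  with x , xj≢xj′ ← sep (Fin.<⇒≢ j<j′)
  = e⁺ , nonconst⁺ , distinct⁺
  where
  agree : ∀ i → c (e i) j ≡ c (e i) j′
  agree i = trans (sym (Fin.finToFun-funToFin {N} {b} (λ i → c (e i) j) i))
                  (trans (cong (λ z → finToFun {b} {N} z i) eq)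
                         (Fin.finToFun-funToFin {N} {b} (λ i → c (e i) j′) i))

  fresh : ∀ i → ¬ (∀ l → c x l ≡ c (e i) l)
  fresh i same = xj≢xj′ (trans (same j) (trans (agree i) (sym (same j′))))

  e⁺ : Fin (suc N) → X
  e⁺ zero    = x
  e⁺ (suc i) = e i

  nonconst⁺ : ∀ i → ∃₂ λ l l′ → c (e⁺ i) l ≢ c (e⁺ i) l′
  nonconst⁺ zero    = j , j′ , xj≢xj′
  nonconst⁺ (suc i) = nonconst i

  distinct⁺ : ∀ i i′ → (∀ l → c (e⁺ i) l ≡ c (e⁺ i′) l) → i ≡ i′
  distinct⁺ zero    zero     _    = refl
  distinct⁺ zero    (suc i′) same = contradiction same (fresh i′)
  distinct⁺ (suc i) zero     same = contradiction (sym ∘ same) (fresh i)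
  distinct⁺ (suc i) (suc i′) same = cong suc (distinct i i′ same)

-- Exponents of abelian groups

module _ {c ℓ} (A : AbelianGroup c ℓ) where
  open AbelianGroup A using (_≈_; _∙_; monoid; group; identityˡ)
    renaming (ε to 0#; refl to ≈-refl; trans to ≈-trans)
  open GroupProperties group using (identityʳ-unique)
  open Mult monoid using (×-homo-+; ×-assocˡ; ×-congʳ; ×-congˡ) renaming (_×_ to _·_)

  ·-zeroʳ : ∀ m → m · 0# ≈ 0#
  ·-zeroʳ zero    = ≈-refl
  ·-zeroʳ (suc m) = ≈-trans (identityˡ (m · 0#)) (·-zeroʳ m)

  -- Two of the n + 1 multiples 0x, ..., nx agree, so some d with 0 < d ≤ n kills x, and d divides
  -- n!. The factorial replaces an appeal to Lagrange's theorem.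
  finite⇒n!·x≈0 : ((n , _) : IsFinite A) → ∀ x → (n !) · x ≈ 0#
  finite⇒n!·x≈0 (n , A↔n) x
    with i , j , i<j , eq ← Fin.pigeonhole (ℕ.n<1+n n) (λ i → Inverse.to A↔n (toℕ i · x))
    = begin
    (n !) · x          ≈⟨ ×-congˡ {x} (ℕ._∣_.equality d∣n!) ⟩
    (q ℕ.* d) · x    ≈⟨ ×-assocˡ x q d ⟨
    q · (d · x)      ≈⟨ ×-congʳ q d·x≈0 ⟩
    q · 0#           ≈⟨ ·-zeroʳ q ⟩
    0#               ∎
    where
    open import Relation.Binary.Reasoning.Setoid (AbelianGroup.setoid A)

    d : ℕ
    d = toℕ j ℕ.∸ toℕ i

    ix≈jx : toℕ i · x ≈ toℕ j · x
    ix≈jx = begin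
      toℕ i · x                                         ≈⟨ Inverse.strictlyInverseʳ A↔n _ ⟨
      Inverse.from A↔n (Inverse.to A↔n (toℕ i · x))     ≡⟨ cong (Inverse.from A↔n) eq ⟩
      Inverse.from A↔n (Inverse.to A↔n (toℕ j · x))     ≈⟨ Inverse.strictlyInverseʳ A↔n _ ⟩
      toℕ j · x                                         ∎

    d·x≈0 : d · x ≈ 0#
    d·x≈0 = identityʳ-unique (toℕ i · x) (d · x) (begin
      toℕ i · x ∙ d · x     ≈⟨ ×-homo-+ x (toℕ i) d ⟨
      (toℕ i ℕ.+ d) · x     ≈⟨ ×-congˡ (ℕ.m+[n∸m]≡n (ℕ.<⇒≤ i<j)) ⟩
      toℕ j · x             ≈⟨ ix≈jx ⟨
      toℕ i · x             ∎)

    0<d≤n⇒d∣n! : ∀ d → 0 ℕ.< d → d ℕ.≤ n → d ℕ.∣ n !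
    0<d≤n⇒d∣n! (suc d) _ d<n = ℕ.∣-trans (ℕ.m∣m*n (d !)) (ℕ.m≤n⇒m!∣n! d<n)

    d∣n! : d ℕ.∣ n !
    d∣n! = 0<d≤n⇒d∣n! d (ℕ.m<n⇒0<n∸m i<j) (ℕ.≤-trans (ℕ.m∸n≤m (toℕ j) (toℕ i)) (Fin.toℕ≤pred[n] j))

    q : ℕ
    q = ℕ._∣_.quotient d∣n!

module _ {c ℓ} (H : AbelianGroup c ℓ) (k : ℕ) where
  private
    K : AbelianGroup c ℓ
    K = (ℤ/2 ^ᴳ k) ×ᴳ H
    module H = AbelianGroup H
    module K = AbelianGroup K
  open Mult K.monoid using (×-assocˡ) renaming (_×_ to _·_)
  open Mult H.monoid using () renaming (_×_ to _·ᴴ_)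

  private
    proj₁-· : ∀ m z → (∀ i → proj₁ z i ≡ 0ℙ) → ∀ i → proj₁ (m · z) i ≡ 0ℙ
    proj₁-· zero    z z≡0 i = refl
    proj₁-· (suc m) z z≡0 i rewrite z≡0 i = proj₁-· m z z≡0 i

    proj₂-· : ∀ m z → proj₂ (m · z) ≡ m ·ᴴ proj₂ z
    proj₂-· zero    z = refl
    proj₂-· (suc m) z = cong (H._∙_ (proj₂ z)) (proj₂-· m z)

    p+[p+0]≡0 : ∀ p → p ℙ.+ (p ℙ.+ 0ℙ) ≡ 0ℙ
    p+[p+0]≡0 0ℙ = refl
    p+[p+0]≡0 1ℙ = refl

  -- Doubling first clears the parities; m then clears the H-component.
  exponent-product : ∀ m → (∀ y → m ·ᴴ y H.≈ H.ε) → ∀ z → (m ℕ.* 2) · z K.≈ K.ε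
  exponent-product m m·y≈0 z =
    K.trans (K.sym (×-assocˡ z m 2))
      ( proj₁-· m (2 · z) (λ i → p+[p+0]≡0 (proj₁ z i))
      , H.trans (H.reflexive (proj₂-· m (2 · z))) (m·y≈0 (proj₂ (2 · z))))

module _ {a b ℓ₁ ℓ₂} (A : AbelianGroup a ℓ₁) (B : AbelianGroup b ℓ₂)
         (A≅B : A ≅ B) where
  private
    module A = AbelianGroup A
    module B = AbelianGroup B
    φ : A.Carrier → B.Carrier
    φ = proj₁ A≅B
  open GroupMorphisms A.rawGroup B.rawGroup
  open IsGroupIsomorphism (proj₂ A≅B) using (ε-homo; ∙-homo; injective)
  open Mult A.monoid using () renaming (_×_ to _·ᴬ_)
  open Mult B.monoid using () renaming (_×_ to _·ᴮ_)

  ≅-· : ∀ m x → φ (m ·ᴬ x) B.≈ m ·ᴮ φ x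
  ≅-· zero    x = ε-homo
  ≅-· (suc m) x = B.trans (∙-homo x (m ·ᴬ x)) (B.∙-congˡ (≅-· m x))

  exponent-≅ : ∀ m → (∀ y → m ·ᴮ y B.≈ B.ε) → ∀ x → m ·ᴬ x A.≈ A.ε
  exponent-≅ m m·y≈0 x =
    injective (B.trans (≅-· m x) (B.trans (m·y≈0 (φ x)) (B.sym ε-homo)))

-- Orthogonality of distinct edges

δ-sym : ∀ {n} (i j : Fin n) → δ i j ≡ δ j i
δ-sym zero    zero    = refl
δ-sym zero    (suc j) = refl
δ-sym (suc i) zero    = refl
δ-sym (suc i) (suc j) = δ-sym i j

δ*δ≡0 : ∀ {n} {i j p q : Fin n} → ¬ (i ≡ p × j ≡ q) → δ i p * δ j q ≡ 0ℤ
δ*δ≡0 {i = i} {j} {p} {q} ≢ with i Fin.≟ p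
... | yes refl = trans (cong (δ i p *_) (δ-off (λ j≡q → ≢ (refl , j≡q)))) (ℤ.*-zeroʳ (δ i p))
... | no i≢p   = trans (cong (_* δ j q) (δ-off i≢p)) (ℤ.*-zeroˡ (δ j q))

edge-orthogonal : ∀ {n} {v w v′ w′ : Fin n} → ¬ (v ≡ v′ × w ≡ w′) → ¬ (v ≡ w′ × w ≡ v′) →
                  ⟪ edge v w , edge v′ w′ ⟫ ≡ 0ℤ
edge-orthogonal {v = v} {w} {v′} {w′} ≢ ≢ʳ = begin
  ⟪ edge v w , edge v′ w′ ⟫             ≡⟨ ⟪edge⟫ v w (edge v′ w′) ⟩
  edge v′ w′ v w - edge v′ w′ w v
    ≡⟨ cong₂ _-_
         (cong₂ _-_ (δ*δ≡0 (λ (p , q) → ≢ (sym p , sym q))) (δ*δ≡0 (λ (p , q) → ≢ʳ (sym p , sym q))))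
         (cong₂ _-_ (δ*δ≡0 (λ (p , q) → ≢ʳ (sym q , sym p))) (δ*δ≡0 (λ (p , q) → ≢ (sym q , sym p)))) ⟩
  0ℤ                                    ∎
  where open ≡-Reasoning

-- Jacobians

module _ (G : Graph) where
  open Graph G
  private module J = AbelianGroup (Jac G)
  open Mult J.monoid using () renaming (_×_ to _·_)

  degree-difference : ∀ v w → degree G (λ p → δ v p - δ w p) ≡ 0ℤ
  degree-difference v w = begin
    ∑[ p < order ] (δ v p - δ w p)    ≡⟨ ∑-distrib-+ (δ v) (λ p → - δ w p) ⟩
    sum (δ v) + sum (λ p → - δ w p)   ≡⟨ cong₂ _+_ (sum-δ-1 v)
                                           (trans (sum-neg (δ w)) (cong -_ (sum-δ-1 w))) ⟩
    0ℤ                                ∎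
    where open ≡-Reasoning

  difference : Vertex → Vertex → Divisor⁰ G
  difference v w = (λ p → δ v p - δ w p) , degree-difference v w

  difference-⁻¹ : ∀ v w → difference w v J.≈ difference v w J.⁻¹
  difference-⁻¹ v w = ≗⇒∼ G (λ p → lemma (δ v p) (δ w p))
    where
    lemma : ∀ a b → b - a ≡ - (a - b)
    lemma = solve-∀

  ·-eval : ∀ m D p → proj₁ (m · D) p ≡ + m * proj₁ D p
  ·-eval zero    D p = sym (ℤ.*-zeroˡ (proj₁ D p))
  ·-eval (suc m) D p =
    trans (cong (_+_ (proj₁ D p)) (·-eval m D p)) (sym (ℤ.suc-* (+ m) (proj₁ D p)))

  -- Differences telescope along paths, so P holds at v - q for a base vertex q and every v. Since D
  -- has degree zero it is the sum of the D(v)(v - q), the multiples of q cancelling.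
  edges-generate : (P : Divisor⁰ G → Set) →
    (∀ D E → D J.≈ E → P D → P E) →
    P J.ε → (∀ D E → P D → P E → P (D J.∙ E)) → (∀ D → P D → P (D J.⁻¹)) →
    (∀ {v w} → Adjacent v w → P (difference v w)) → ∀ D → P D
  edges-generate P resp P-ε P-∙ P-⁻¹ P-edge D@(D′ , deg≡0) =
    resp (proj₁ total) D (≗⇒∼ G total≗D) (proj₁ (proj₂ total))
    where
    path : ∀ {v w} → Star Adjacent v w → P (difference v w)
    path {v} ε = resp J.ε (difference v v) (≗⇒∼ G (λ p → sym (ℤ.+-inverseʳ (δ v p)))) P-ε
    path {v} {w} (_◅_ {j = u} v~u u⋆w) =
      resp (difference v u J.∙ difference u w) (difference v w)
           (≗⇒∼ G (λ p → lemma (δ v p) (δ u p) (δ w p)))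
           (P-∙ _ _ (P-edge v~u) (path u⋆w))
      where
      lemma : ∀ a b c → (a - b) + (b - c) ≡ a - c
      lemma = solve-∀

    P-· : ∀ m E → P E → P (m · E)
    P-· zero    E PE = P-ε
    P-· (suc m) E PE = P-∙ E (m · E) PE (P-· m E PE)

    multiple : ∀ c E → P E → ∃[ F ] P F × (∀ p → proj₁ F p ≡ c * proj₁ E p)
    multiple (+ m)    E PE = m · E , P-· m E PE , ·-eval m E
    multiple -[1+ m ] E PE =
      (suc m · E) J.⁻¹ , P-⁻¹ _ (P-· (suc m) E PE) , λ p →
      trans (cong -_ (·-eval (suc m) E p)) (ℤ.neg-distribˡ-* (+ suc m) (proj₁ E p))

    P-sum : ∀ {n} (t : Fin n → Divisor⁰ G) → (∀ i → P (t i)) →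
            ∃[ F ] P F × (∀ p → proj₁ F p ≡ ∑[ i < n ] proj₁ (t i) p)
    P-sum {zero}  t Pt = J.ε , P-ε , λ _ → refl
    P-sum {suc n} t Pt with F , PF , F≡ ← P-sum (t ∘ suc) (Pt ∘ suc) =
      t zero J.∙ F , P-∙ (t zero) F (Pt zero) PF , λ p → cong (_+_ (proj₁ (t zero) p)) (F≡ p)

    q : Vertex
    q = fromℕ< (ℕ.>-nonZero⁻¹ order {{nonEmpty}})

    term : ∀ v → ∃[ F ] P F × (∀ p → proj₁ F p ≡ D′ v * (δ v p - δ q p))
    term v = multiple (D′ v) (difference v q) (path (connected v q))

    total : ∃[ F ] P F × (∀ p → proj₁ F p ≡ ∑[ v < order ] proj₁ (proj₁ (term v)) p)
    total = P-sum (proj₁ ∘ term) (λ v → proj₁ (proj₂ (term v)))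

    total≗D : ∀ p → proj₁ (proj₁ total) p ≡ D′ p
    total≗D p = begin
      proj₁ (proj₁ total) p
        ≡⟨ proj₂ (proj₂ total) p ⟩
      ∑[ v < order ] proj₁ (proj₁ (term v)) p
        ≡⟨ sum-cong-≗ (λ v → trans (proj₂ (proj₂ (term v)) p)
             (trans (cong (λ d → D′ v * (d - δ q p)) (δ-sym v p)) (expand (D′ v) (δ p v) (δ q p)))) ⟩
      ∑[ v < order ] (1ℤ * (δ p v * D′ v) + - δ q p * D′ v)
        ≡⟨ sum-lin 1ℤ (- δ q p) (λ v → δ p v * D′ v) D′ ⟩
      1ℤ * ∑[ v < order ] (δ p v * D′ v) + - δ q p * sum D′
        ≡⟨ cong₂ (λ x y → 1ℤ * x + - δ q p * y) (sum-δ p D′) deg≡0 ⟩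
      1ℤ * D′ p + - δ q p * 0ℤ
        ≡⟨ collect (D′ p) (δ q p) ⟩
      D′ p ∎
      where
      open ≡-Reasoning
      expand : ∀ d a b → d * (a - b) ≡ 1ℤ * (a * d) + - b * d
      expand = solve-∀
      collect : ∀ x y → 1ℤ * x + - y * 0ℤ ≡ x
      collect = solve-∀

-- Bounding k in terms of H

bit : Parity → Fin 2
bit 0ℙ = zero
bit 1ℙ = suc zero

bit-injective : ∀ {p q} → bit p ≡ bit q → p ≡ q
bit-injective {0ℙ} {0ℙ} _ = refl
bit-injective {1ℙ} {1ℙ} _ = refl

-- The multiplier comes from n! killing H and 2 killing the other factor, so it depends neither on G
-- nor on k.
exponent-Jac : ∀ {c ℓ} (H : AbelianGroup c ℓ) ((n , _) : IsFinite H) {G k} →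
               Jac G ≅ (ℤ/2 ^ᴳ k) ×ᴳ H →
               ∀ D → ∃[ f ] (∀ v → + (n ! ℕ.* 2) * proj₁ D v ≡ div G f v)
exponent-Jac H finite@(n , _) {G} {k} Jac≅K D = proj₁ mD≈0 , λ v → begin
  + m * proj₁ D v            ≡⟨ ·-eval G m D v ⟨
  proj₁ (m · D) v            ≡⟨ ℤ.+-identityʳ _ ⟨
  proj₁ (m · D) v - 0ℤ       ≡⟨ proj₂ mD≈0 v ⟩
  div G (proj₁ mD≈0) v       ∎
  where
  open ≡-Reasoning
  module J = AbelianGroup (Jac G)
  open Mult J.monoid using () renaming (_×_ to _·_)
  m : ℕ
  m = n ! ℕ.* 2
  mD≈0 : (m · D) J.≈ J.ε
  mD≈0 = exponent-≅ (Jac G) ((ℤ/2 ^ᴳ k) ×ᴳ H) Jac≅K m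
           (exponent-product H k (n !) (finite⇒n!·x≈0 H finite)) D

module _ {c ℓ} (H : AbelianGroup c ℓ) (finite : IsFinite H)
         (G : Graph) (simple : IsSimple G) (k : ℕ) (Jac≅K : Jac G ≅ (ℤ/2 ^ᴳ k) ×ᴳ H)
         (m : ℕ) .{{_ : ℕ.NonZero m}}
         (mD≈0 : ∀ (D : Divisor⁰ G) → ∃[ f ] (∀ v → + m * proj₁ D v ≡ div G f v)) where
  open Graph G
  open Chains G simple
  private
    M : ℤ
    M = + m
  open Reflection M
  private
    K : AbelianGroup c ℓ
    K = (ℤ/2 ^ᴳ k) ×ᴳ H
    module H = AbelianGroup H
    module J = AbelianGroup (Jac G)
    module K = AbelianGroup K
    n : ℕ
    n = proj₁ finite
    H↔n = proj₂ finite
    φ : J.Carrier → K.Carrier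
    φ = proj₁ Jac≅K
  open GroupMorphisms J.rawGroup K.rawGroup
  open IsGroupIsomorphism (proj₂ Jac≅K)
    using (⟦⟧-cong; ∙-homo; ε-homo; ⁻¹-homo; injective; surjective)

  private
    α : Divisor⁰ G → Fin k → Parity
    α D = proj₁ (φ D)

    α-cong : ∀ D E → D J.≈ E → ∀ j → α D j ≡ α E j
    α-cong D E D≈E = proj₁ (⟦⟧-cong {D} {E} D≈E)

    -- Every element of ℤ/2 is its own inverse. Hence edges with distinct parity vectors differ even
    -- as unoriented edges.
    α-reverse : ∀ v w j → α (difference G w v) j ≡ α (difference G v w) j
    α-reverse v w j =
      trans (α-cong (difference G w v) (difference G v w J.⁻¹) (difference-⁻¹ G v w) j)
            (proj₁ (⁻¹-homo (difference G v w)) j)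

    Edge : Set
    Edge = ∃₂ λ v w → Adjacent v w

    column : Edge → Fin k → Fin 2
    column (v , w , _) j = bit (α (difference G v w) j)

    indicator : Fin k → Fin k → Parity
    indicator j l with j Fin.≟ l
    ... | yes _ = 1ℙ
    ... | no  _ = 0ℙ

    indicator-separates : ∀ {j j′} → j ≢ j′ → indicator j j ≢ indicator j j′
    indicator-separates {j} {j′} j≢j′ with j Fin.≟ j | j Fin.≟ j′
    ... | _      | yes p = contradiction p j≢j′
    ... | no p   | _     = contradiction refl p
    ... | yes _  | no _  = λ ()

    -- If no edge separated j from j′, the classes with equal parities there would form a subgroup
    -- containing all edges, hence all of Jac(G). Surjectivity supplies a class whose parity vector
    -- is the indicator of j, a contradiction.
    separating-edge : ∀ {j j′} → j ≢ j′ → ∃[ e ] column e j ≢ column e j′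
    separating-edge {j} {j′} j≢j′
      with Fin.any? (λ v → Fin.any? (λ w → (0 ℕ.<? mult v w) ×-dec
             ¬? (α (difference G v w) j ℙ.≟ α (difference G v w) j′)))
    ... | yes (v , w , v~w , ≢) = (v , w , v~w) , ≢ ∘ bit-injective
    ... | no none = contradiction (begin
      indicator j j   ≡⟨ proj₁ D↦ j ⟨
      α D j           ≡⟨ edges-generate G P P-resp P-ε P-∙ P-⁻¹ P-edge D ⟩
      α D j′          ≡⟨ proj₁ D↦ j′ ⟩
      indicator j j′  ∎) (indicator-separates j≢j′)
      where
      open ≡-Reasoning
      D : Divisor⁰ G
      D = proj₁ (surjective (indicator j , H.ε))
      D↦ : φ D K.≈ (indicator j , H.ε)
      D↦ = proj₂ (surjective (indicator j , H.ε)) {D} (J.refl {D})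
      P : Divisor⁰ G → Set
      P E = α E j ≡ α E j′
      P-resp : ∀ E F → E J.≈ F → P E → P F
      P-resp E F E≈F PE = trans (sym (α-cong E F E≈F j)) (trans PE (α-cong E F E≈F j′))
      P-ε : P J.ε
      P-ε = trans (proj₁ ε-homo j) (sym (proj₁ ε-homo j′))
      P-∙ : ∀ E F → P E → P F → P (E J.∙ F)
      P-∙ E F PE PF = trans (proj₁ (∙-homo E F) j)
        (trans (cong₂ ℙ._+_ PE PF) (sym (proj₁ (∙-homo E F) j′)))
      P-⁻¹ : ∀ E → P E → P (E J.⁻¹)
      P-⁻¹ E PE = trans (proj₁ (⁻¹-homo E) j) (trans PE (sym (proj₁ (⁻¹-homo E) j′)))
      P-edge : ∀ {v w} → Adjacent v w → P (difference G v w)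
      P-edge {v} {w} v~w = decidable-stable (α (difference G v w) j ℙ.≟ α (difference G v w) j′)
        (λ ≢ → none (v , w , v~w , ≢))

    torsion : ∀ v w → ∃[ f ] (∀ p → div G f p ≡ M * ∂ (edge v w) p)
    torsion v w = proj₁ f , λ p →
      trans (sym (proj₂ f p)) (cong (M *_) (sym (∂-edge v w p)))
      where
      f : ∃[ f ] (∀ p → M * (δ v p - δ w p) ≡ div G f p)
      f = mD≈0 (difference G v w)

    potential : Vertex → Vertex → Vertex → ℤ
    potential v w = proj₁ (torsion v w)

    R : Vertex → Vertex → Matrix order
    R v w = reflect (potential v w) (edge v w)

    class : Edge → Fin n
    class (v , w , _) = Inverse.to H↔n (proj₂ (φ (difference G v w)))

    -- Doubling erases the parities and `class` determines the H-component, so the doubled classes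
    -- have equal images and `injective` pulls this back.
    class≡⇒double≈ : ∀ (e@(v , w , _) e′@(v′ , w′ , _) : Edge) → class e ≡ class e′ →
      (difference G v w J.∙ difference G v w) J.≈ (difference G v′ w′ J.∙ difference G v′ w′)
    class≡⇒double≈ (v , w , _) (v′ , w′ , _) eq =
      injective {D J.∙ D} {D′ J.∙ D′}
        (K.trans (∙-homo D D) (K.trans
          ( (λ j → trans (ℙ.p+p≡0ℙ (α D j)) (sym (ℙ.p+p≡0ℙ (α D′ j))))
          , H.∙-cong y≈y′ y≈y′)
          (K.sym (∙-homo D′ D′))))
      where
      D D′ : Divisor⁰ G
      D = difference G v w
      D′ = difference G v′ w′
      y≈y′ : proj₂ (φ D) H.≈ proj₂ (φ D′)
      y≈y′ = H.trans (H.sym (Inverse.strictlyInverseʳ H↔n (proj₂ (φ D))))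
        (H.trans (H.reflexive (cong (Inverse.from H↔n) eq))
                 (Inverse.strictlyInverseʳ H↔n (proj₂ (φ D′))))

    class≡⇒R≡ : ∀ (e@(v , w , _) e′@(v′ , w′ , _) : Edge) → class e ≡ class e′ →
                ∀ p q → M ∣ R v w p q - R v′ w′ p q
    class≡⇒R≡ e@(v , w , _) e′@(v′ , w′ , _) eq with class≡⇒double≈ e e′ eq
    ... | g , 2D≡ = reflect-cong {potential v w} {potential v′ w′} {g} {edge v w} {edge v′ w′}
                      (proj₂ (torsion v w)) (proj₂ (torsion v′ w′)) λ p → begin
      + 2 * ∂ (edge v w) p - + 2 * ∂ (edge v′ w′) p
        ≡⟨ cong₂ (λ x y → + 2 * x - + 2 * y) (∂-edge v w p) (∂-edge v′ w′ p) ⟩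
      + 2 * (δ v p - δ w p) - + 2 * (δ v′ p - δ w′ p)
        ≡⟨ double (δ v p - δ w p) (δ v′ p - δ w′ p) ⟩
      (δ v p - δ w p) + (δ v p - δ w p) - ((δ v′ p - δ w′ p) + (δ v′ p - δ w′ p))
        ≡⟨ 2D≡ p ⟩
      div G g p ∎
      where
      open ≡-Reasoning
      double : ∀ x y → + 2 * x - + 2 * y ≡ x + x - (y + y)
      double = solve-∀

    -- By `reflect∣⇒div` the divisor v - w is principal, so its image under the isomorphism is zero.
    R≡0⇒const : ∀ ((v , w , _) : Edge) → (∀ p q → M ∣ R v w p q) →
                ∀ l → α (difference G v w) l ≡ 0ℙ
    R≡0⇒const (v , w , v~w) M∣R l =
      trans (α-cong (difference G v w) J.ε D≈ε l) (proj₁ ε-homo l)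
      where
      trivial : ∃[ g ] (∀ p → ∂ (edge v w) p ≡ div G g p)
      trivial = reflect∣⇒div {potential v w} v~w (proj₂ (torsion v w)) M∣R
      D≈ε : difference G v w J.≈ J.ε
      D≈ε = proj₁ trivial ,
        λ p → trans (ℤ.+-identityʳ _) (trans (sym (∂-edge v w p)) (proj₂ trivial p))

    -- Two different parities cannot both be zero, so M cannot divide all of `R v w`.
    nonconst⇒R≢0 : ∀ (e@(v , w , _) : Edge) {j j′} → column e j ≢ column e j′ →
                   ∃₂ λ p q → ¬ M ∣ R v w p q
    nonconst⇒R≢0 e@(v , w , _) {j} {j′} ≢ = nonmultiple-entry M (R v w) λ M∣R →
      ≢ (cong bit (trans (R≡0⇒const e M∣R j) (sym (R≡0⇒const e M∣R j′))))

    M*M*2≡ : M * M * + 2 ≡ + (m ℕ.* m ℕ.* 2)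
    M*M*2≡ = trans (cong (_* + 2) (sym (ℤ.pos-* m m))) (sym (ℤ.pos-* (m ℕ.* m) 2))

    same-column : ∀ (e@(v , w , _) e′@(v′ , w′ , _) : Edge) → v ≡ v′ × w ≡ w′ →
                  ∀ l → column e l ≡ column e′ l
    same-column _ _ (refl , refl) l = refl

    reversed-column : ∀ (e@(v , w , _) e′@(v′ , w′ , _) : Edge) → v ≡ w′ × w ≡ v′ →
                      ∀ l → column e l ≡ column e′ l
    reversed-column (v , w , _) _ (refl , refl) l = cong bit (sym (α-reverse v w l))

    module _ {N} (e : Fin (suc N) → Edge)
             (nonconst : ∀ i → ∃₂ λ j j′ → column (e i) j ≢ column (e i) j′)
             (distinct : ∀ i i′ → (∀ j → column (e i) j ≡ column (e i′) j) → i ≡ i′) where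

      r : Fin (suc N) → Matrix order
      r i = R (proj₁ (e i)) (proj₁ (proj₂ (e i)))

      -- Equal or reversed edges have the same parity vector, so `distinct` makes different members
      -- of the family orthogonal, and the isometry scales inner products by M².
      orthogonal : ∀ i j → ⟪ r i , r j ⟫ ≡ M * M * + 2 * δ i j
      orthogonal i j = begin
        ⟪ R v w , R v′ w′ ⟫
          ≡⟨ reflect-isometry {potential v w} {potential v′ w′} (edge-isChain v~w)
               (edge-isChain (proj₂ (proj₂ (e j)))) (proj₂ (torsion v w)) (proj₂ (torsion v′ w′)) ⟩
        M * M * ⟪ edge v w , edge v′ w′ ⟫
          ≡⟨ cong (M * M *_) edges ⟩
        M * M * (+ 2 * δ i j)
          ≡⟨ ℤ.*-assoc (M * M) (+ 2) (δ i j) ⟨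
        M * M * + 2 * δ i j ∎
        where
        open ≡-Reasoning
        v w v′ w′ : Vertex
        v  = proj₁ (e i)
        w  = proj₁ (proj₂ (e i))
        v′ = proj₁ (e j)
        w′ = proj₁ (proj₂ (e j))
        v~w : Adjacent v w
        v~w = proj₂ (proj₂ (e i))
        edges : ⟪ edge v w , edge v′ w′ ⟫ ≡ + 2 * δ i j
        edges with i Fin.≟ j
        ... | yes refl = trans (edge-norm (adjacent⇒≢ v~w)) (sym (cong (+ 2 *_) (δ-diag i)))
        ... | no i≢j   = trans
          (edge-orthogonal (i≢j ∘ distinct i j ∘ same-column (e i) (e j))
                           (i≢j ∘ distinct i j ∘ reversed-column (e i) (e j)))
          (sym (cong (+ 2 *_) (δ-off i≢j)))

      entry≢0 : ∀ i → ∃₂ λ p q → ¬ M ∣ r i p q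
      entry≢0 i = nonconst⇒R≢0 (e i) (proj₂ (proj₂ (nonconst i)))

      -- Within a class the matrices agree modulo M, so non-divisibility by M at the entry chosen
      -- for i passes to j, where mere nonvanishing would not.
      class≡⇒entry≢0 : ∀ i j → class (e i) ≡ class (e j) →
                       r j (proj₁ (entry≢0 i)) (proj₁ (proj₂ (entry≢0 i))) ≢ 0ℤ
      class≡⇒entry≢0 i j eq rj≡0 = proj₂ (proj₂ (entry≢0 i))
        (subst (M ∣_) (trans (cong (λ x → r i p q - x) rj≡0) (ℤ.+-identityʳ (r i p q)))
               (class≡⇒R≡ (e i) (e j) eq p q))
        where
        p = proj₁ (entry≢0 i)
        q = proj₁ (proj₂ (entry≢0 i))

      family-bound : suc N ℕ.≤ n ℕ.* (m ℕ.* m ℕ.* 2)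
      family-bound = ℤ.drop‿+≤+ (ℤ.≤-trans
        (packing r (subst (0ℤ ≤_) (sym M*M*2≡) (+≤+ z≤n)) orthogonal (class ∘ e)
          (proj₁ ∘ entry≢0) (λ i → proj₁ (proj₂ (entry≢0 i))) class≡⇒entry≢0)
        (ℤ.≤-reflexive (trans (cong (+ n *_) M*M*2≡) (sym (ℤ.pos-* n (m ℕ.* m ℕ.* 2))))))

  -- For larger k, `separating-family` with two colours would give one edge more than `family-bound`
  -- allows.
  rank-bound : k ℕ.≤ 2 ℕ.^ suc (n ℕ.* (m ℕ.* m ℕ.* 2))
  rank-bound = ℕ.≮⇒≥ λ bound<k →
    let e , nonconst , distinct = separating-family column separating-edge _ bound<k
    in ℕ.<-irrefl refl (family-bound e nonconst distinct)

theorem6 : ∀ {c ℓ : Level} (H : AbelianGroup c ℓ) → IsFinite H →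
    ∃[ k-H ] (∀ (k : ℕ) → k > k-H → ¬ (∃[ G ] (IsSimple G × Jac G ≅ (ℤ/2 ^ᴳ k) ×ᴳ H)))
-- Unification fills in the right-hand side of `rank-bound` with m = n! · 2, which depends on H only
-- through n.
theorem6 H finite@(n , _) = _ , λ k k>k-H (G , simple , Jac≅K) →
  ℕ.<⇒≱ k>k-H (rank-bound H finite G simple k Jac≅K (n ! ℕ.* 2) {{ℕ.m*n≢0 (n !) 2 {{n ℕ.!≢0}}}}
                (exponent-Jac H finite {G} Jac≅K))
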